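{- Let $N\ge1$ and $1\le E\le D$ be integers. Let $[A]_{D+E}=[A]_D+[\Delta A]_E\,t^D$ with $[A]_D=\sum_{d=0}^{D-1}A_dt^d$, $[\Delta A]_E=\sum_{d=0}^{E-1}A_{D+d}t^d$, where all $A_d\in\mathbb R^{N\times N}$ are symmetric and $A_0$ has $N$ distinct eigenvalues. Let $[Q]_D=\sum_{d=0}^{D-1}Q_dt^d$ and $[\Lambda]_D=\sum_{d=0}^{D-1}\Lambda_dt^d$ with $Q_d,\Lambda_d\in\mathbb R^{N\times N}$ satisfy $$[Q]_D^T[A]_D[Q]_D\stackrel{D}{=}[\Lambda]_D,\qquad [Q]_D^T[Q]_D\stackrel{D}{=}I,\qquad [\Lambda]_D\text{ diagonal}.$$ Define successively: 1. $[\Delta F]_E$ and $[\Delta G]_E$ by $[\Delta F]_E\,t^D\stackrel{D+E}{=}[Q]_D^T[A]_D[Q]_D-[\Lambda]_D$ and $[\Delta G]_E\,t^D\stackrel{D+E}{=}[Q]_D^T[Q]_D-I$; 2. $[S]_E\stackrel{E}{=}-\tfrac12[\Delta G]_E$; 3. $[K]_E\stackrel{E}{=}[\Delta F]_E+[Q]_E^T[\Delta A]_E[Q]_E+[S]_E[\Lambda]_E+[\Lambda]_E[S]_E$; 4. $[\Delta\Lambda]_E\stackrel{E}{=}I\circ[K]_E$; 5. $[H_{ij}]_E\stackrel{E}{=}([\lambda_j]_E-[\lambda_i]_E)^{ -1}$ if $i\ne j$ and $[H_{ij}]_E=0$ if $i=j$, where $[\lambda_i]_E$ is the $i$-th diagonal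 entry of $[\Lambda]_E$; 6. $[\Delta Q]_E\stackrel{E}{=}[Q]_E\big([H]_E\circ([K]_E-[\Delta\Lambda]_E)+[S]_E\big)$. Then $[Q]_{D+E}:=[Q]_D+[\Delta Q]_E\,t^D$ and $[\Lambda]_{D+E}:=[\Lambda]_D+[\Delta\Lambda]_E\,t^D$ satisfy $$[Q]_{D+E}^T[A]_{D+E}[Q]_{D+E}\stackrel{D+E}{=}[\Lambda]_{D+E},\qquad [Q]_{D+E}^T[Q]_{D+E}\stackrel{D+E}{=}I,\qquad [\Lambda]_{D+E}\text{ diagonal}.$$
   Context: For polynomials (or power series) in $t$ with matrix coefficients, $\stackrel{D}{=}$ means equality of the coefficients of $t^0,\dots,t^{D-1}$, i.e. equality modulo $t^D$. $[X]_D$ denotes a matrix polynomial of degree at most $D-1$ in $t$ with real matrix coefficients, representing an element modulo $t^D$. For $E\le D$, $[X]_E$ denotes the truncation of $[X]_D$ modulo $t^E$. Inverses of scalar polynomials in Step 5 are taken modulo $t^E$. The transpose acts coefficientwise. $\circ$ is the Hadamard (entrywise) product, with entries multiplied modulo $t^E$, so $I\circ K$ is the diagonal part of $K$. $I$ is the $N\times N$ identity matrix. A matrix polynomial is diagonal if all its coefficients are diagonal. -}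

module Defs where

open import Algebra.Bundles.Raw using (RawRing)
import Algebra.Definitions.RawMonoid as RawMonoidDefs
open import Data.Bool.Base using (if_then_else_)
open import Data.Fin.Base using (Fin; zero; suc; toℕ; inject≤)
import Data.Fin.Properties as Fin
open import Data.Nat.Base as ℕ using (ℕ; zero; suc; _∸_; _⊔_)
import Data.Nat.Properties as ℕ
open import Data.Product.Base using (∃; _×_; _,_)
open import Data.Rational.Base as ℚ using (ℚ; 0ℚ; 1ℚ; ½; ∣_∣; 1/_)
import Data.Rational.Properties as ℚ
open import Data.Rational.Solver using (module +-*-Solver)
open import Data.Sum.Base using (_⊎_)
open import Data.Vec.Functional using (Vector)
open import Level using (0ℓ)
open import Relation.Binary.PropositionalEquality
  using (_≡_; _≢_; refl; sym; cong; cong₂; subst)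
open import Relation.Nullary.Decidable using (does)

------------------------------------------------------------------------
-- Real numbers: Cauchy sequences of rationals, up to _≈ᴿ_

Cauchy : (ℕ → ℚ) → Set
Cauchy x = ∀ ε → 0ℚ ℚ.< ε →
  ∃ λ M → ∀ m n → M ℕ.≤ m → M ℕ.≤ n → ∣ x m ℚ.- x n ∣ ℚ.< ε

record ℝ : Set where
  constructor mkℝ
  field
    seq    : ℕ → ℚ
    cauchy : Cauchy seq

open ℝ public

infix 4 _≈ᴿ_ _<ᴿ_ _#_

-- A record, so that x and y can be inferred from a proof of x ≈ᴿ y.
record _≈ᴿ_ (x y : ℝ) : Set where
  constructor mk≈
  field
    close : ∀ ε → 0ℚ ℚ.< ε →
      ∃ λ M → ∀ n → M ℕ.≤ n → ∣ seq x n ℚ.- seq y n ∣ ℚ.< ε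

_<ᴿ_ : ℝ → ℝ → Set
x <ᴿ y = ∃ λ ε → 0ℚ ℚ.< ε ×
  (∃ λ M → ∀ n → M ℕ.≤ n → seq x n ℚ.+ ε ℚ.< seq y n)

-- Apartness is the constructive reading of "distinct" for real numbers;
-- classically it is the negation of _≈ᴿ_.
_#_ : ℝ → ℝ → Set
x # y = x <ᴿ y ⊎ y <ᴿ x

private abstract
  0<½ε : ∀ ε → 0ℚ ℚ.< ε → 0ℚ ℚ.< ½ ℚ.* ε
  0<½ε ε 0<ε =
    subst (ℚ._< ½ ℚ.* ε) (ℚ.*-zeroʳ ½) (ℚ.*-monoʳ-<-pos ½ 0<ε)

  ½ε+½ε : ∀ ε → ½ ℚ.* ε ℚ.+ ½ ℚ.* ε ≡ ε
  ½ε+½ε = solve 1 (λ e → con ½ :* e :+ con ½ :* e := e) refl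
    where open +-*-Solver

  +-cauchy : ∀ x y → Cauchy x → Cauchy y → Cauchy (λ n → x n ℚ.+ y n)
  +-cauchy x y cx cy ε 0<ε
    with cx (½ ℚ.* ε) (0<½ε ε 0<ε) | cy (½ ℚ.* ε) (0<½ε ε 0<ε)
  ... | M , hx | M′ , hy = M ⊔ M′ , λ m n p q → begin-strict
    ∣ (x m ℚ.+ y m) ℚ.- (x n ℚ.+ y n) ∣
      ≡⟨ cong ∣_∣ (rearrange (x m) (y m) (x n) (y n)) ⟩
    ∣ (x m ℚ.- x n) ℚ.+ (y m ℚ.- y n) ∣
      ≤⟨ ℚ.∣p+q∣≤∣p∣+∣q∣ (x m ℚ.- x n) (y m ℚ.- y n) ⟩
    ∣ x m ℚ.- x n ∣ ℚ.+ ∣ y m ℚ.- y n ∣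
      <⟨ ℚ.+-mono-< (hx m n (ℕ.m⊔n≤o⇒m≤o M M′ p) (ℕ.m⊔n≤o⇒m≤o M M′ q))
                    (hy m n (ℕ.m⊔n≤o⇒n≤o M M′ p) (ℕ.m⊔n≤o⇒n≤o M M′ q)) ⟩
    ½ ℚ.* ε ℚ.+ ½ ℚ.* ε
      ≡⟨ ½ε+½ε ε ⟩
    ε ∎
    where
    open ℚ.≤-Reasoning
    rearrange : ∀ a b c d →
      (a ℚ.+ b) ℚ.- (c ℚ.+ d) ≡ (a ℚ.- c) ℚ.+ (b ℚ.- d)
    rearrange = solve 4
      (λ a b c d → (a :+ b) :- (c :+ d) := (a :- c) :+ (b :- d)) refl
      where open +-*-Solver

  neg-cauchy : ∀ x → Cauchy x → Cauchy (λ n → ℚ.- x n)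
  neg-cauchy x cx ε 0<ε with cx ε 0<ε
  ... | M , hx = M , λ m n p q →
    subst (ℚ._< ε) (cong ∣_∣ (rearrange (x m) (x n))) (hx n m q p)
    where
    rearrange : ∀ a b → b ℚ.- a ≡ (ℚ.- a) ℚ.- (ℚ.- b)
    rearrange = solve 2 (λ a b → b :- a := (:- a) :- (:- b)) refl
      where open +-*-Solver

  0<1 : 0ℚ ℚ.< 1ℚ
  0<1 = ℚ.positive⁻¹ 1ℚ

  bounded : ∀ x → Cauchy x → ∃ λ M → ∃ λ B →
    0ℚ ℚ.< B × (∀ n → M ℕ.≤ n → ∣ x n ∣ ℚ.≤ B)
  bounded x cx with cx 1ℚ 0<1
  ... | M , hx = M , 1ℚ ℚ.+ ∣ x M ∣
      , ℚ.+-mono-<-≤ 0<1 (ℚ.0≤∣p∣ (x M))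
      , λ n p → begin
    ∣ x n ∣
      ≡⟨ cong ∣_∣ (rearrange (x n) (x M)) ⟩
    ∣ (x n ℚ.- x M) ℚ.+ x M ∣
      ≤⟨ ℚ.∣p+q∣≤∣p∣+∣q∣ (x n ℚ.- x M) (x M) ⟩
    ∣ x n ℚ.- x M ∣ ℚ.+ ∣ x M ∣
      ≤⟨ ℚ.+-monoˡ-≤ ∣ x M ∣ (ℚ.<⇒≤ (hx n M p ℕ.≤-refl)) ⟩
    1ℚ ℚ.+ ∣ x M ∣ ∎
    where
    open ℚ.≤-Reasoning
    rearrange : ∀ a b → a ≡ (a ℚ.- b) ℚ.+ b
    rearrange = solve 2 (λ a b → a := (a :- b) :+ b) refl
      where open +-*-Solver

  divide : ∀ B ε → 0ℚ ℚ.< B → 0ℚ ℚ.< ε →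
    ∃ λ δ → 0ℚ ℚ.< δ × B ℚ.* δ ≡ ε
  divide B ε 0<B 0<ε = 1/B ℚ.* ε
      , subst (ℚ._< 1/B ℚ.* ε) (ℚ.*-zeroʳ 1/B) (ℚ.*-monoʳ-<-pos 1/B 0<ε)
      , (begin-equality
    B ℚ.* (1/B ℚ.* ε)  ≡⟨ sym (ℚ.*-assoc B 1/B ε) ⟩
    (B ℚ.* 1/B) ℚ.* ε  ≡⟨ cong (ℚ._* ε) (ℚ.*-inverseʳ B) ⟩
    1ℚ ℚ.* ε           ≡⟨ ℚ.*-identityˡ ε ⟩
    ε                  ∎)
    where
    open ℚ.≤-Reasoning
    instance
      B-pos : ℚ.Positive B
      B-pos = ℚ.positive 0<B
      B-nonZero : ℚ.NonZero B
      B-nonZero = ℚ.pos⇒nonZero B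
    1/B : ℚ
    1/B = 1/ B
    instance
      1/B-pos : ℚ.Positive 1/B
      1/B-pos = ℚ.1/pos⇒pos B

  ∣p∣*∣q∣<B*δ : ∀ p q {B δ} → 0ℚ ℚ.< B → ∣ p ∣ ℚ.≤ B → ∣ q ∣ ℚ.< δ →
    ∣ p ∣ ℚ.* ∣ q ∣ ℚ.< B ℚ.* δ
  ∣p∣*∣q∣<B*δ p q {B} {δ} 0<B p≤B q<δ = begin-strict
    ∣ p ∣ ℚ.* ∣ q ∣
      ≤⟨ ℚ.*-monoʳ-≤-nonNeg ∣ q ∣ {{ℚ.∣-∣-nonNeg q}} p≤B ⟩
    B ℚ.* ∣ q ∣
      <⟨ ℚ.*-monoʳ-<-pos B {{ℚ.positive 0<B}} q<δ ⟩
    B ℚ.* δ ∎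
    where open ℚ.≤-Reasoning

  product-close : ∀ a b c d {B C δ γ ε} → 0ℚ ℚ.< B → 0ℚ ℚ.< C →
    B ℚ.* δ ≡ ½ ℚ.* ε → C ℚ.* γ ≡ ½ ℚ.* ε →
    ∣ a ∣ ℚ.≤ B → ∣ b ℚ.- d ∣ ℚ.< δ → ∣ d ∣ ℚ.≤ C → ∣ a ℚ.- c ∣ ℚ.< γ →
    ∣ a ℚ.* b ℚ.- c ℚ.* d ∣ ℚ.< ε
  product-close a b c d {B} {C} {δ} {γ} {ε} 0<B 0<C Bδ≡ Cγ≡ a≤B b-d<δ d≤C a-c<γ =
    begin-strict
    ∣ a ℚ.* b ℚ.- c ℚ.* d ∣
      ≡⟨ cong ∣_∣ (rearrange a b c d) ⟩
    ∣ a ℚ.* (b ℚ.- d) ℚ.+ d ℚ.* (a ℚ.- c) ∣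
      ≤⟨ ℚ.∣p+q∣≤∣p∣+∣q∣ (a ℚ.* (b ℚ.- d)) (d ℚ.* (a ℚ.- c)) ⟩
    ∣ a ℚ.* (b ℚ.- d) ∣ ℚ.+ ∣ d ℚ.* (a ℚ.- c) ∣
      ≡⟨ cong₂ ℚ._+_ (ℚ.∣p*q∣≡∣p∣*∣q∣ a (b ℚ.- d)) (ℚ.∣p*q∣≡∣p∣*∣q∣ d (a ℚ.- c)) ⟩
    ∣ a ∣ ℚ.* ∣ b ℚ.- d ∣ ℚ.+ ∣ d ∣ ℚ.* ∣ a ℚ.- c ∣
      <⟨ ℚ.+-mono-< (∣p∣*∣q∣<B*δ a (b ℚ.- d) 0<B a≤B b-d<δ)
                    (∣p∣*∣q∣<B*δ d (a ℚ.- c) 0<C d≤C a-c<γ) ⟩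
    B ℚ.* δ ℚ.+ C ℚ.* γ
      ≡⟨ cong₂ ℚ._+_ Bδ≡ Cγ≡ ⟩
    ½ ℚ.* ε ℚ.+ ½ ℚ.* ε
      ≡⟨ ½ε+½ε ε ⟩
    ε ∎
    where
    open ℚ.≤-Reasoning
    rearrange : ∀ a b c d → a ℚ.* b ℚ.- c ℚ.* d
                          ≡ a ℚ.* (b ℚ.- d) ℚ.+ d ℚ.* (a ℚ.- c)
    rearrange = solve 4
      (λ a b c d → a :* b :- c :* d := a :* (b :- d) :+ d :* (a :- c)) refl
      where open +-*-Solver

  *-cauchy : ∀ x y → Cauchy x → Cauchy y → Cauchy (λ n → x n ℚ.* y n)
  *-cauchy x y cx cy ε 0<ε =
    let M₁ , B , 0<B , x≤B = bounded x cx
        M₂ , C , 0<C , y≤C = bounded y cy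
        δ , 0<δ , Bδ≡ = divide B (½ ℚ.* ε) 0<B (0<½ε ε 0<ε)
        γ , 0<γ , Cγ≡ = divide C (½ ℚ.* ε) 0<C (0<½ε ε 0<ε)
        M₃ , hy = cy δ 0<δ
        M₄ , hx = cx γ 0<γ
    in (M₁ ⊔ M₂) ⊔ (M₃ ⊔ M₄) , λ m n p q →
      let p₁₂ = ℕ.m⊔n≤o⇒m≤o (M₁ ⊔ M₂) (M₃ ⊔ M₄) p
          p₃₄ = ℕ.m⊔n≤o⇒n≤o (M₁ ⊔ M₂) (M₃ ⊔ M₄) p
          q₁₂ = ℕ.m⊔n≤o⇒m≤o (M₁ ⊔ M₂) (M₃ ⊔ M₄) q
          q₃₄ = ℕ.m⊔n≤o⇒n≤o (M₁ ⊔ M₂) (M₃ ⊔ M₄) q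
      in product-close (x m) (y m) (x n) (y n) 0<B 0<C Bδ≡ Cγ≡
           (x≤B m (ℕ.m⊔n≤o⇒m≤o M₁ M₂ p₁₂))
           (hy m n (ℕ.m⊔n≤o⇒m≤o M₃ M₄ p₃₄) (ℕ.m⊔n≤o⇒m≤o M₃ M₄ q₃₄))
           (y≤C n (ℕ.m⊔n≤o⇒n≤o M₁ M₂ q₁₂))
           (hx m n (ℕ.m⊔n≤o⇒n≤o M₃ M₄ p₃₄) (ℕ.m⊔n≤o⇒n≤o M₃ M₄ q₃₄))

fromℚ : ℚ → ℝ
fromℚ q = mkℝ (λ _ → q) λ ε 0<ε →
  0 , λ _ _ _ _ → subst (λ r → ∣ r ∣ ℚ.< ε) (sym (ℚ.+-inverseʳ q)) 0<ε

infixl 6 _+ᴿ_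
infixl 7 _*ᴿ_
infix  8 -ᴿ_

_+ᴿ_ _*ᴿ_ : ℝ → ℝ → ℝ
mkℝ x cx +ᴿ mkℝ y cy = mkℝ (λ n → x n ℚ.+ y n) (+-cauchy x y cx cy)
mkℝ x cx *ᴿ mkℝ y cy = mkℝ (λ n → x n ℚ.* y n) (*-cauchy x y cx cy)

-ᴿ_ : ℝ → ℝ
-ᴿ mkℝ x cx = mkℝ (λ n → ℚ.- x n) (neg-cauchy x cx)

0ᴿ 1ᴿ : ℝ
0ᴿ = fromℚ 0ℚ
1ᴿ = fromℚ 1ℚ

ℝ-rawRing : RawRing 0ℓ 0ℓ
ℝ-rawRing = record
  { _≈_ = _≈ᴿ_ ; _+_ = _+ᴿ_ ; _*_ = _*ᴿ_ ; -_ = -ᴿ_ ; 0# = 0ᴿ ; 1# = 1ᴿ }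

------------------------------------------------------------------------
-- Matrices and formal power series over a ring

matrixRing : ∀ {c ℓ} → RawRing c ℓ → ℕ → RawRing c ℓ
matrixRing R N = record
  { Carrier = Fin N → Fin N → Carrier
  ; _≈_     = λ X Y → ∀ i j → X i j ≈ Y i j
  ; _+_     = λ X Y i j → X i j + Y i j
  ; _*_     = λ X Y i j → sum (λ k → X i k * Y k j)
  ; -_      = λ X i j → - X i j
  ; 0#      = λ _ _ → 0#
  ; 1#      = λ i j → if does (i Fin.≟ j) then 1# else 0#
  }
  where
  open RawRing R
  open RawMonoidDefs +-rawMonoid using (sum)

seriesRing : ∀ {c ℓ} → RawRing c ℓ → RawRing c ℓ
seriesRing R = record
  { Carrier = ℕ → Carrier
  ; _≈_     = λ f g → ∀ d → f d ≈ g d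
  ; _+_     = λ f g d → f d + g d
  ; _*_     = λ f g d → sum {suc d} (λ k → f (toℕ k) * g (d ∸ toℕ k))
  ; -_      = λ f d → - f d
  ; 0#      = λ _ → 0#
  ; 1#      = λ { zero → 1# ; (suc _) → 0# }
  }
  where
  open RawRing R
  open RawMonoidDefs +-rawMonoid using (sum)

------------------------------------------------------------------------
-- Real matrices and their spectra

Matrix : ℕ → Set
Matrix N = RawRing.Carrier (matrixRing ℝ-rawRing N)

Symmetric : ∀ {N} → Matrix N → Set
Symmetric X = ∀ i j → X i j ≈ᴿ X j i

IsDiagonal : ∀ {N} → Matrix N → Set
IsDiagonal X = ∀ i j → i ≢ j → X i j ≈ᴿ 0ᴿ

IsEigenvalue : ∀ {N} → Matrix N → ℝ → Set
IsEigenvalue {N} X μ = ∃ λ (v : Vector ℝ N) →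
  (∃ λ i → v i # 0ᴿ) × (∀ i → sum (λ j → X i j *ᴿ v j) ≈ᴿ μ *ᴿ v i)
  where
  open RawMonoidDefs (RawRing.+-rawMonoid ℝ-rawRing) using (sum)

HasDistinctEigenvalues : ∀ {N} → Matrix N → Set
HasDistinctEigenvalues {N} X = ∃ λ (μ : Vector ℝ N) →
  (∀ i j → i ≢ j → μ i # μ j) × (∀ i → IsEigenvalue X (μ i))

------------------------------------------------------------------------
-- Series in t with real or real-matrix coefficients

Series : Set
Series = RawRing.Carrier (seriesRing ℝ-rawRing)

MatSeries : ℕ → Set
MatSeries N = RawRing.Carrier (seriesRing (matrixRing ℝ-rawRing N))

module _ {N : ℕ} where
  open RawRing (seriesRing (matrixRing ℝ-rawRing N)) public
    using (_+_; _*_; -_) renaming (0# to O; 1# to I)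

open RawRing (seriesRing ℝ-rawRing) public
  using () renaming (_+_ to _+ₛ_; _*_ to _*ₛ_; -_ to -ₛ_; 0# to 0ₛ; 1# to 1ₛ)

infix 4 _≈[_]_ _≈ₛ[_]_
infixl 6 _-_
infixr 7 _·_
infixl 7 _⊙_
infixl 8 _*t^_
infix 9 _ᵀ

record _≈[_]_ {N : ℕ} (X : MatSeries N) (D : ℕ) (Y : MatSeries N) : Set where
  constructor mk≈[]
  open RawRing (matrixRing ℝ-rawRing N) using (_≈_)
  field
    coeff≈ : ∀ d → d ℕ.< D → X d ≈ Y d

record _≈ₛ[_]_ (f : Series) (D : ℕ) (g : Series) : Set where
  constructor mk≈ₛ[]
  field
    coeff≈ : ∀ d → d ℕ.< D → f d ≈ᴿ g d

_-_ : ∀ {N} → MatSeries N → MatSeries N → MatSeries N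
X - Y = X + (- Y)

_·_ : ∀ {N} → ℝ → MatSeries N → MatSeries N
(c · X) d i j = c *ᴿ X d i j

_*t^_ : ∀ {N} → MatSeries N → ℕ → MatSeries N
(X *t^ zero)        = X
(X *t^ suc D) zero    = O zero
(X *t^ suc D) (suc d) = (X *t^ D) d

_ᵀ : ∀ {N} → MatSeries N → MatSeries N
(X ᵀ) d i j = X d j i

entry : ∀ {N} → MatSeries N → Fin N → Fin N → Series
entry X i j d = X d i j

-- Entries are multiplied as series, not coefficient by coefficient.
_⊙_ : ∀ {N} → MatSeries N → MatSeries N → MatSeries N
(X ⊙ Y) d i j = (entry X i j *ₛ entry Y i j) d

Diagonal : ∀ {N} → MatSeries N → Set
Diagonal X = ∀ d → IsDiagonal (X d)

Decomposes : ∀ {N} → ℕ → (A Q Λ : MatSeries N) → Set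
Decomposes D A Q Λ =
  (Q ᵀ * A * Q ≈[ D ] Λ) × (Q ᵀ * Q ≈[ D ] I) × Diagonal Λ

------------------------------------------------------------------------
-- [X]_D: polynomials of degree at most D − 1, given by D coefficients

MatPoly : ℕ → ℕ → Set
MatPoly N D = Fin D → Matrix N

⟦_⟧ : ∀ {N D} → MatPoly N D → MatSeries N
⟦_⟧ {D = zero}  X d       = O d
⟦_⟧ {D = suc D} X zero    = X zero
⟦_⟧ {D = suc D} X (suc d) = ⟦ (λ k → X (suc k)) ⟧ d

truncate : ∀ {N D E} → E ℕ.≤ D → MatPoly N D → MatPoly N E
truncate E≤D X k = X (inject≤ k E≤D)

------------------------------------------------------------------------
-- The quantities defined successively from A, ΔA, Q and Λ.  They are
-- specified by congruences only, so an element of Update also exhibits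
-- them as well defined: Qᵀ A Q − Λ and Qᵀ Q − I are divisible by t^D, and
-- each λⱼ − λᵢ (i ≠ j) is invertible modulo t^E.

record Update {N D E : ℕ} (E≤D : E ℕ.≤ D)
              (A : MatPoly N D) (ΔA : MatPoly N E) (Q Λ : MatPoly N D) : Set where
  Q′ : MatPoly N E
  Q′ = truncate E≤D Q

  Λ′ : MatPoly N E
  Λ′ = truncate E≤D Λ

  λ′ : Fin N → Series
  λ′ = λ i → entry ⟦ Λ′ ⟧ i i

  field
    ΔF ΔG S K ΔΛ H ΔQ : MatPoly N E

    ΔF-eq : ⟦ ΔF ⟧ *t^ D ≈[ D ℕ.+ E ] ⟦ Q ⟧ ᵀ * ⟦ A ⟧ * ⟦ Q ⟧ - ⟦ Λ ⟧
    ΔG-eq : ⟦ ΔG ⟧ *t^ D ≈[ D ℕ.+ E ] ⟦ Q ⟧ ᵀ * ⟦ Q ⟧ - I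
    S-eq  : ⟦ S ⟧ ≈[ E ] fromℚ (ℚ.- ½) · ⟦ ΔG ⟧
    K-eq  : ⟦ K ⟧ ≈[ E ] ⟦ ΔF ⟧ + ⟦ Q′ ⟧ ᵀ * ⟦ ΔA ⟧ * ⟦ Q′ ⟧
                        + ⟦ S ⟧ * ⟦ Λ′ ⟧ + ⟦ Λ′ ⟧ * ⟦ S ⟧
    ΔΛ-eq : ⟦ ΔΛ ⟧ ≈[ E ] I ⊙ ⟦ K ⟧
    H-off : ∀ i j → i ≢ j →
      entry ⟦ H ⟧ i j *ₛ (λ′ j +ₛ (-ₛ λ′ i)) ≈ₛ[ E ] 1ₛ
    H-diag : ∀ i → entry ⟦ H ⟧ i i ≈ₛ[ E ] 0ₛ
    ΔQ-eq : ⟦ ΔQ ⟧ ≈[ E ] ⟦ Q′ ⟧ * (⟦ H ⟧ ⊙ (⟦ K ⟧ - ⟦ ΔΛ ⟧) + ⟦ S ⟧)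

{-# OPTIONS --safe #-}
-- Everything is an identity between matrix series modulo t^(D+E), in which products of
-- two multiples of t^D vanish because E ≤ D.  To first order in t^D the defect of
-- orthogonality becomes ΔG + (T + Tᵀ) with T = Qᵀ ΔQ = G + S and G = H ∘ (K − ΔΛ); it
-- vanishes since S = −½ ΔG is symmetric and G is antisymmetric.  The defect of
-- diagonality becomes K + (Λ G − G Λ), where H is chosen so that the commutator cancels
-- the off-diagonal part of K.
--
-- The λⱼ − λᵢ are invertible because their constant terms are: these are differences of
-- eigenvalues of A₀.  Here one needs Q₀ Q₀ᵀ = I, which follows from Q₀ᵀ Q₀ = I as I − Q₀ Q₀ᵀ
-- is a symmetric idempotent of trace 0, and its trace is the sum of its squared entries.
module Submission where

open import Defs using
  ( ℝ; mkℝ; seq; cauchy; Cauchy; _≈ᴿ_; mk≈; _<ᴿ_; _#_; fromℚ; 0ᴿ; 1ᴿ; _+ᴿ_; _*ᴿ_; -ᴿ_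
  ; matrixRing; seriesRing )

open import Algebra.Bundles using (CommutativeMonoid; CommutativeRing; Monoid; Ring)
open import Algebra.Bundles.Raw using (RawRing)
import Algebra.Definitions.RawMonoid as RawMonoidDefs
import Algebra.Properties.CommutativeMonoid.Sum as CommutativeMonoidSum
import Algebra.Properties.CommutativeSemigroup as CommutativeSemigroupProperties
import Algebra.Properties.Monoid.Sum as MonoidSum
import Algebra.Properties.Ring as RingProperties
import Algebra.Properties.Semiring.Sum as SemiringSum
import Algebra.Solver.CommutativeMonoid as CommutativeMonoidSolver
open import Data.Bool.Base using (if_then_else_)
open import Data.Fin.Base using (Fin; zero; suc; toℕ; fromℕ<; inject≤; punchOut)
import Data.Fin.Properties as Fin
open import Data.Nat.Base as ℕ using (ℕ; zero; suc; _∸_; _≤_) renaming (_+_ to _+ℕ_)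
import Data.Nat.Properties as ℕ
open import Data.Product.Base using (∃; _×_; _,_; proj₁; proj₂)
open import Data.Rational.Base as ℚ using (ℚ; 0ℚ; 1ℚ; ½; ∣_∣; 1/_)
import Data.Rational.Properties as ℚ
open import Data.Rational.Solver using (module +-*-Solver)
open import Data.Sum.Base using (_⊎_; inj₁; inj₂; [_,_]′)
open import Function.Base using (_∘_; flip)
open import Function.Definitions using (Injective)
open import Level using (0ℓ; _⊔_)
open import Relation.Binary.Core using (Rel)
open import Relation.Binary.PropositionalEquality as ≡
  using (_≡_; _≢_; refl; cong; cong₂; subst)
import Relation.Binary.Reasoning.Setoid as ≈-Reasoning
open import Relation.Binary.Structures using (IsEquivalence)
open import Relation.Nullary.Decidable using (Dec; yes; no; from-no; dec-true; dec-false)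
open import Relation.Nullary.Negation using (¬_; contradiction)

-- Orthogonality modulo t^(D+E) fixes only the symmetric part `S` of T = Qᵀ ΔQ; the antisymmetric
-- part `G` remains free and is spent on the off-diagonal part of `K`. Correctness is claimed for
-- every solution of the specifying congruences, not only for a constructed one. The antisymmetry of
-- `G` must therefore come from the uniqueness of inverses modulo t^E, and the symmetry of `ΔF` and
-- `ΔG` from dividing symmetric residuals by t^D. The obstacle on the existence side is that
-- equality of Cauchy reals is not decidable, so one cannot look up which eigenvalue a diagonal
-- entry of Λ₀ equals. Apartness is turned into invertibility, and locality of the ring picks, for
-- each eigenvector, an invertible coordinate with respect to the columns of Q₀. This labels every
-- eigenvalue of A₀ with a position on the diagonal. Distinctness makes the labelling injective,
-- finiteness makes it surjective, and so distinct diagonal entries of Λ₀ are distinct eigenvalues.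
-- The algebra is done over any commutative ring that is local and formally real; the reals enter
-- only through these two properties.

module _ {c ℓ} (M : Monoid c ℓ) where
  open Monoid M
  open MonoidSum M using (sum; sum-cong-≋; sum-replicate-zero)

  sum-only : ∀ {n} (t : Fin n → Carrier) i → (∀ k → k ≢ i → t k ≈ ε) → sum t ≈ t i
  sum-only {suc n} t zero t≈ε = trans
    (∙-congˡ (trans (sum-cong-≋ (λ k → t≈ε (suc k) λ ())) (sum-replicate-zero n)))
    (identityʳ (t zero))
  sum-only {suc n} t (suc i) t≈ε = trans
    (∙-cong (t≈ε zero λ ())
            (sum-only (t ∘ suc) i (λ k k≢i → t≈ε (suc k) (k≢i ∘ Fin.suc-injective))))
    (identityˡ (t (suc i)))

-- Matrices over a ring.

module MatrixRing {c ℓ} (R : Ring c ℓ) (N : ℕ) where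
  open Ring R hiding (zero) renaming (refl to ≈-refl)
  open SemiringSum semiring
  private module M = RawRing (matrixRing rawRing N)

  δ-diagonal : ∀ i → M.1# i i ≡ 1#
  δ-diagonal i = cong (if_then 1# else 0#) (dec-true (i Fin.≟ i) refl)

  δ-off-diagonal : ∀ {i j} → i ≢ j → M.1# i j ≡ 0#
  δ-off-diagonal {i} {j} i≢j = cong (if_then 1# else 0#) (dec-false (i Fin.≟ j) i≢j)

  *-diagonalˡ : ∀ X Y → (∀ i j → i ≢ j → X i j ≈ 0#) →
    ∀ i j → (X M.* Y) i j ≈ X i i * Y i j
  *-diagonalˡ X Y diag i j = sum-only +-monoid _ i λ k k≢i →
    trans (*-congʳ (diag i k (k≢i ∘ ≡.sym))) (zeroˡ (Y k j))

  *-diagonalʳ : ∀ X Y → (∀ i j → i ≢ j → Y i j ≈ 0#) →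
    ∀ i j → (X M.* Y) i j ≈ X i j * Y j j
  *-diagonalʳ X Y diag i j = sum-only +-monoid _ j λ k k≢j →
    trans (*-congˡ (diag k j k≢j)) (zeroʳ (X i k))

  *-assoc′ : ∀ X Y Z → ((X M.* Y) M.* Z) M.≈ (X M.* (Y M.* Z))
  *-assoc′ X Y Z i j = begin
    sum (λ k → sum (λ l → X i l * Y l k) * Z k j)
      ≈⟨ sum-cong-≋ (λ k → *-distribʳ-sum (Z k j) (λ l → X i l * Y l k)) ⟩
    sum (λ k → sum (λ l → (X i l * Y l k) * Z k j))
      ≈⟨ ∑-comm (λ k l → (X i l * Y l k) * Z k j) ⟩
    sum (λ l → sum (λ k → (X i l * Y l k) * Z k j))
      ≈⟨ sum-cong-≋ (λ l → sum-cong-≋ (λ k → *-assoc (X i l) (Y l k) (Z k j))) ⟩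
    sum (λ l → sum (λ k → X i l * (Y l k * Z k j)))
      ≈⟨ sum-cong-≋ (λ l → *-distribˡ-sum (X i l) (λ k → Y l k * Z k j)) ⟨
    sum (λ l → X i l * sum (λ k → Y l k * Z k j)) ∎
    where open ≈-Reasoning setoid

  matrix : Ring c ℓ
  matrix = record
    { M
    ; isRing = record
      { +-isAbelianGroup = record
        { isGroup = record
          { isMonoid = record
            { isSemigroup = record
              { isMagma = record
                { isEquivalence = record
                  { refl  = λ i j → ≈-refl
                  ; sym   = λ e i j → sym (e i j)
                  ; trans = λ e f i j → trans (e i j) (f i j)
                  }
                ; ∙-cong = λ e f i j → +-cong (e i j) (f i j)
                }
              ; assoc = λ X Y Z i j → +-assoc (X i j) (Y i j) (Z i j)
              }
            ; identity = (λ X i j → +-identityˡ (X i j)) , (λ X i j → +-identityʳ (X i j))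
            }
          ; inverse = (λ X i j → -‿inverseˡ (X i j)) , (λ X i j → -‿inverseʳ (X i j))
          ; ⁻¹-cong = λ e i j → -‿cong (e i j)
          }
        ; comm = λ X Y i j → +-comm (X i j) (Y i j)
        }
      ; *-cong = λ e f i j → sum-cong-≋ (λ k → *-cong (e i k) (f k j))
      ; *-assoc = *-assoc′
      ; *-identity =
          (λ X i j → trans (*-diagonalˡ M.1# X (λ k l k≢l → reflexive (δ-off-diagonal k≢l)) i j)
            (trans (*-congʳ (reflexive (δ-diagonal i))) (*-identityˡ (X i j))))
        , (λ X i j → trans (*-diagonalʳ X M.1# (λ k l k≢l → reflexive (δ-off-diagonal k≢l)) i j)
            (trans (*-congˡ (reflexive (δ-diagonal j))) (*-identityʳ (X i j))))
      ; distrib =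
          (λ X Y Z i j → trans
            (sum-cong-≋ (λ k → distribˡ (X i k) (Y k j) (Z k j)))
            (∑-distrib-+ (λ k → X i k * Y k j) (λ k → X i k * Z k j)))
        , (λ X Y Z i j → trans
            (sum-cong-≋ (λ k → distribʳ (X k j) (Y i k) (Z i k)))
            (∑-distrib-+ (λ k → Y i k * X k j) (λ k → Z i k * X k j)))
      }
    }

  open RawMonoidDefs M.+-rawMonoid using () renaming (sum to sumᴹ)

  -- Products of matrix series add up whole matrices; this passes to scalar sums, so that a single
  -- entry of such a product can be treated as a scalar convolution.
  sum-entry : ∀ {n} (t : Fin n → M.Carrier) i j → sumᴹ t i j ≡ sum (λ k → t k i j)
  sum-entry {zero}  t i j = refl
  sum-entry {suc n} t i j = cong (t zero i j +_) (sum-entry (t ∘ suc) i j)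

-- Convolution sums in a commutative monoid.

module Convolution {c ℓ} (M : CommutativeMonoid c ℓ) where
  open CommutativeMonoid M
    using (Carrier; _≈_; setoid; trans; sym; assoc; comm; identityˡ; identityʳ; monoid)
    renaming
    ( _∙_ to _+_; ε to 0#; refl to ≈-refl
    ; ∙-cong to +-cong; ∙-congˡ to +-congˡ; ∙-congʳ to +-congʳ )
  open CommutativeMonoidSum M using (sum; sum-cong-≋; ∑-distrib-+)
  open ≈-Reasoning setoid

  -- A general `h a b` takes the place of the product of two coefficients, so that reordering and
  -- regrouping need addition only and also serve when the coefficients do not commute.
  conv : (ℕ → ℕ → Carrier) → ℕ → Carrier
  conv h d = sum {suc d} (λ k → h (toℕ k) (d ∸ toℕ k))

  -- The bounds on the indices matter for congruences modulo t^n, which say nothing about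
  -- coefficients from n on.
  conv-cong-≤ : ∀ h h′ d → (∀ a b → a ℕ.≤ d → b ℕ.≤ d → h a b ≈ h′ a b) →
    conv h d ≈ conv h′ d
  conv-cong-≤ h h′ d h≈h′ = sum-cong-≋ {suc d} λ k →
    h≈h′ (toℕ k) (d ∸ toℕ k) (Fin.toℕ≤pred[n] k) (ℕ.m∸n≤m d (toℕ k))

  conv-cong : ∀ h h′ d → (∀ a b → h a b ≈ h′ a b) → conv h d ≈ conv h′ d
  conv-cong h h′ d h≈h′ = conv-cong-≤ h h′ d (λ a b _ _ → h≈h′ a b)

  conv-0 : ∀ h d → (∀ a b → a ℕ.≤ d → b ℕ.≤ d → h a b ≈ 0#) → conv h d ≈ 0#
  conv-0 h d h≈0 = trans (conv-cong-≤ h (λ _ _ → 0#) d h≈0) (zeros (suc d))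
    where open CommutativeMonoidSum M renaming (sum-replicate-zero to zeros)

  conv-+ : ∀ h h′ d → conv (λ a b → h a b + h′ a b) d ≈ conv h d + conv h′ d
  conv-+ h h′ d = ∑-distrib-+ {suc d}
    (λ k → h (toℕ k) (d ∸ toℕ k)) (λ k → h′ (toℕ k) (d ∸ toℕ k))

  -- `sum` unfolds at the first index; this unfolds the convolution at the opposite end.
  conv-last : ∀ h d → conv h (suc d) ≈ conv (λ a b → h a (suc b)) d + h (suc d) 0
  conv-last h zero = trans (+-congˡ (identityʳ (h 1 0))) (+-congʳ (sym (identityʳ (h 0 1))))
  conv-last h (suc d) = begin
    h 0 (suc (suc d)) + conv (h ∘ suc) (suc d)
      ≈⟨ +-congˡ (conv-last (h ∘ suc) d) ⟩
    h 0 (suc (suc d)) + (conv (λ a b → h (suc a) (suc b)) d + h (suc (suc d)) 0)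
      ≈⟨ assoc _ _ _ ⟨
    conv (λ a b → h a (suc b)) (suc d) + h (suc (suc d)) 0 ∎

  conv-flip : ∀ h d → conv h d ≈ conv (flip h) d
  conv-flip h zero = ≈-refl
  conv-flip h (suc d) = begin
    h 0 (suc d) + conv (h ∘ suc) d
      ≈⟨ comm _ _ ⟩
    conv (h ∘ suc) d + h 0 (suc d)
      ≈⟨ +-congʳ (conv-flip (h ∘ suc) d) ⟩
    conv (flip (h ∘ suc)) d + h 0 (suc d)
      ≈⟨ conv-last (flip h) d ⟨
    conv (flip h) (suc d) ∎

  -- Both sides add `φ i j k` over i + j + k = d. The induction separates the terms with i = 0: on
  -- the right they are the first summand, on the left they are spread over all inner sums and
  -- collected by `conv-+`.
  conv-assoc : ∀ (φ : ℕ → ℕ → ℕ → Carrier) d →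
    conv (λ n k → conv (λ i j → φ i j k) n) d ≈ conv (λ i n → conv (φ i) n) d
  conv-assoc φ zero = ≈-refl
  conv-assoc φ (suc d) = begin
    (φ 0 0 (suc d) + 0#) + conv (λ n k → φ 0 (suc n) k + conv (λ i j → φ (suc i) j k) n) d
      ≈⟨ +-cong (identityʳ _) (conv-+ (λ n k → φ 0 (suc n) k) (λ n k → conv (λ i j → φ (suc i) j k) n) d) ⟩
    φ 0 0 (suc d) + (conv (λ n k → φ 0 (suc n) k) d + conv (λ n k → conv (λ i j → φ (suc i) j k) n) d)
      ≈⟨ assoc _ _ _ ⟨
    conv (φ 0) (suc d) + conv (λ n k → conv (λ i j → φ (suc i) j k) n) d
      ≈⟨ +-congˡ (conv-assoc (φ ∘ suc) d) ⟩
    conv (φ 0) (suc d) + conv (λ i n → conv (φ (suc i)) n) d ∎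

-- Power series over a ring and congruence modulo t^n.

coarsen : ∀ {c ℓ ℓ′} (S : Ring c ℓ) (let open Ring S) {_~_ : Rel Carrier ℓ′} →
  IsEquivalence _~_ →
  (∀ {x y} → x ≈ y → x ~ y) →
  (∀ {x x′ y y′} → x ~ x′ → y ~ y′ → (x + y) ~ (x′ + y′)) →
  (∀ {x x′ y y′} → x ~ x′ → y ~ y′ → (x * y) ~ (x′ * y′)) →
  (∀ {x x′} → x ~ x′ → (- x) ~ (- x′)) →
  Ring c ℓ′
coarsen S {_~_} equiv ≈⇒~ +-cong′ *-cong′ -‿cong′ = record
  { Carrier = Carrier ; _≈_ = _~_ ; _+_ = _+_ ; _*_ = _*_ ; -_ = -_ ; 0# = 0# ; 1# = 1#
  ; isRing = record
    { +-isAbelianGroup = record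
      { isGroup = record
        { isMonoid = record
          { isSemigroup = record
            { isMagma = record { isEquivalence = equiv ; ∙-cong = +-cong′ }
            ; assoc = λ x y z → ≈⇒~ (+-assoc x y z)
            }
          ; identity = (λ x → ≈⇒~ (+-identityˡ x)) , (λ x → ≈⇒~ (+-identityʳ x))
          }
        ; inverse = (λ x → ≈⇒~ (-‿inverseˡ x)) , (λ x → ≈⇒~ (-‿inverseʳ x))
        ; ⁻¹-cong = -‿cong′
        }
      ; comm = λ x y → ≈⇒~ (+-comm x y)
      }
    ; *-cong = *-cong′
    ; *-assoc = λ x y z → ≈⇒~ (*-assoc x y z)
    ; *-identity = (λ x → ≈⇒~ (*-identityˡ x)) , (λ x → ≈⇒~ (*-identityʳ x))
    ; distrib = (λ x y z → ≈⇒~ (distribˡ x y z)) , (λ x y z → ≈⇒~ (distribʳ x y z))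
    }
  }
  where open Ring S

module SeriesRing {c ℓ} (R : Ring c ℓ) where
  open Ring R hiding (zero) renaming (refl to ≈-refl)
  open RingProperties R
  open SemiringSum semiring using (*-distribˡ-sum; *-distribʳ-sum)
  open Convolution +-commutativeMonoid public
  private module S = RawRing (seriesRing rawRing)

  infixr 7 _⊗_
  _⊗_ : S.Carrier → S.Carrier → ℕ → ℕ → Carrier
  (f ⊗ g) a b = f a * g b

  infix 4 _∼[_]_
  record _∼[_]_ (f : S.Carrier) (n : ℕ) (g : S.Carrier) : Set ℓ where
    constructor mk∼
    field at : ∀ d → d ℕ.< n → f d ≈ g d
  open _∼[_]_ public

  *-cong-mod : ∀ {n f f′ g g′} → f ∼[ n ] f′ → g ∼[ n ] g′ → f S.* g ∼[ n ] f′ S.* g′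
  *-cong-mod {f = f} {f′} {g} {g′} f∼f′ g∼g′ = mk∼ λ d d<n →
    conv-cong-≤ (f ⊗ g) (f′ ⊗ g′) d λ a b a≤d b≤d →
    *-cong (at f∼f′ a (ℕ.≤-<-trans a≤d d<n)) (at g∼g′ b (ℕ.≤-<-trans b≤d d<n))

  *-distribˡ-conv : ∀ x h d → x * conv h d ≈ conv (λ a b → x * h a b) d
  *-distribˡ-conv x h d = *-distribˡ-sum {suc d} x (λ k → h (toℕ k) (d ∸ toℕ k))

  *-distribʳ-conv : ∀ x h d → conv h d * x ≈ conv (λ a b → h a b * x) d
  *-distribʳ-conv x h d = *-distribʳ-sum {suc d} x (λ k → h (toℕ k) (d ∸ toℕ k))

  *-assocˢ : ∀ f g h d → ((f S.* g) S.* h) d ≈ (f S.* (g S.* h)) d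
  *-assocˢ f g h d = begin
    conv (λ n k → (f S.* g) n * h k) d
      ≈⟨ conv-cong _ _ d (λ n k → *-distribʳ-conv (h k) (f ⊗ g) n) ⟩
    conv (λ n k → conv (λ i j → (f i * g j) * h k) n) d
      ≈⟨ conv-assoc (λ i j k → (f i * g j) * h k) d ⟩
    conv (λ i n → conv (λ j k → (f i * g j) * h k) n) d
      ≈⟨ conv-cong _ _ d (λ i n → conv-cong _ _ n (λ j k → *-assoc (f i) (g j) (h k))) ⟩
    conv (λ i n → conv (λ j k → f i * (g j * h k)) n) d
      ≈⟨ conv-cong _ _ d (λ i n → *-distribˡ-conv (f i) (g ⊗ h) n) ⟨
    conv (λ i n → f i * (g S.* h) n) d ∎
    where open ≈-Reasoning setoid

  const : Carrier → S.Carrier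
  const x zero    = x
  const x (suc _) = 0#

  const-* : ∀ x g d → (const x S.* g) d ≈ x * g d
  const-* x g zero    = +-identityʳ (x * g 0)
  const-* x g (suc d) = trans (+-congˡ (conv-0 ((λ _ → 0#) ⊗ g) d λ a b _ _ → zeroˡ (g b))) (+-identityʳ _)

  *-identityˡˢ : ∀ g d → (S.1# S.* g) d ≈ g d
  *-identityˡˢ g d = trans
    (conv-cong (S.1# ⊗ g) (const 1# ⊗ g) d λ { zero b → ≈-refl ; (suc a) b → ≈-refl })
    (trans (const-* 1# g d) (*-identityˡ (g d)))

  *-identityʳˢ : ∀ f d → (f S.* S.1#) d ≈ f d
  *-identityʳˢ f zero    = trans (+-identityʳ (f 0 * 1#)) (*-identityʳ (f 0))
  *-identityʳˢ f (suc d) = trans (conv-last (f ⊗ S.1#) d)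
    (trans (+-cong (conv-0 (f ⊗ (λ _ → 0#)) d λ a b _ _ → zeroʳ (f a)) (*-identityʳ (f (suc d))))
           (+-identityˡ (f (suc d))))

  series : Ring c ℓ
  series = record
    { S
    ; isRing = record
      { +-isAbelianGroup = record
        { isGroup = record
          { isMonoid = record
            { isSemigroup = record
              { isMagma = record
                { isEquivalence = record
                  { refl  = λ d → ≈-refl
                  ; sym   = λ e d → sym (e d)
                  ; trans = λ e f d → trans (e d) (f d)
                  }
                ; ∙-cong = λ e f d → +-cong (e d) (f d)
                }
              ; assoc = λ f g h d → +-assoc (f d) (g d) (h d)
              }
            ; identity = (λ f d → +-identityˡ (f d)) , (λ f d → +-identityʳ (f d))
            }
          ; inverse = (λ f d → -‿inverseˡ (f d)) , (λ f d → -‿inverseʳ (f d))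
          ; ⁻¹-cong = λ e d → -‿cong (e d)
          }
        ; comm = λ f g d → +-comm (f d) (g d)
        }
      ; *-cong = λ {f} {f′} {g} {g′} e e′ d → conv-cong (f ⊗ g) (f′ ⊗ g′) d (λ a b → *-cong (e a) (e′ b))
      ; *-assoc = *-assocˢ
      ; *-identity = *-identityˡˢ , *-identityʳˢ
      ; distrib =
          (λ f g h d → trans
            (conv-cong (f ⊗ (g S.+ h)) _ d λ a b → distribˡ (f a) (g b) (h b))
            (conv-+ (f ⊗ g) (f ⊗ h) d))
        , (λ f g h d → trans
            (conv-cong ((g S.+ h) ⊗ f) _ d λ a b → distribʳ (f b) (g a) (h a))
            (conv-+ (g ⊗ f) (h ⊗ f) d))
      }
    }

  -- Every term of coefficient d contains either `u 0` or a coefficient of `v` of index below d.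
  -- This is the one coefficient gained in each step of the inversion below.
  *-vanish : ∀ {n u v} → u 0 ≈ 0# → v ∼[ n ] S.0# → u S.* v ∼[ suc n ] S.0#
  *-vanish {n} {u} {v} u₀≈0 v∼0 = mk∼ vanish
    where
    u₀*≈0 : ∀ x → u 0 * x ≈ 0#
    u₀*≈0 x = trans (*-congʳ u₀≈0) (zeroˡ x)

    vanish : ∀ d → d ℕ.< suc n → (u S.* v) d ≈ 0#
    vanish zero    _            = trans (+-identityʳ (u 0 * v 0)) (u₀*≈0 (v 0))
    vanish (suc d) (ℕ.s≤s d<n) = trans
      (+-cong (u₀*≈0 (v (suc d)))
              (conv-0 (u ∘ suc ⊗ v) d λ a b _ b≤d →
                trans (*-congˡ (at v∼0 b (ℕ.≤-<-trans b≤d d<n))) (zeroʳ (u (suc a)))))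
      (+-identityˡ 0#)

  -- The approximations g ↦ x + (1 − x f) g of the inverse gain one coefficient per step,
  -- because 1 − (x + (1 − x f) g) f = (1 − x f) (1 − g f).
  left-inverse : ∀ n f x → x * f 0 ≈ 1# → ∃ λ g → g S.* f ∼[ n ] S.1#
  left-inverse n f x xf₀≈1 = approx n , mk∼ λ d d<n → sym (x∙y⁻¹≈ε⇒x≈y _ _ (at (1-gf∼0 n) d d<n))
    where
    open Ring series using () renaming
      ( _-_ to _-ˢ_; setoid to setoidˢ; distribʳ to distribʳˢ; distribˡ to distribˡˢ
      ; +-congˡ to +-congˡˢ; +-congʳ to +-congʳˢ; -‿cong to -‿congˢ; +-assoc to +-assocˢ)
    module P = RingProperties series
    u : S.Carrier
    u = S.1# -ˢ (const x S.* f)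

    u₀≈0 : u 0 ≈ 0#
    u₀≈0 = trans (+-congˡ (-‿cong (trans (const-* x f 0) xf₀≈1))) (-‿inverseʳ 1#)

    approx : ℕ → S.Carrier
    approx zero    = S.0#
    approx (suc n) = const x S.+ (u S.* approx n)

    step : ∀ g → (S.1# -ˢ ((const x S.+ (u S.* g)) S.* f)) S.≈ (u S.* (S.1# -ˢ (g S.* f)))
    step g = begin
      S.1# -ˢ ((const x S.+ (u S.* g)) S.* f)
        ≈⟨ +-congˡˢ {x = S.1#} (-‿congˢ (distribʳˢ f (const x) (u S.* g))) ⟩
      S.1# -ˢ ((const x S.* f) S.+ ((u S.* g) S.* f))
        ≈⟨ +-congˡˢ {x = S.1#} (P.-‿+-comm (const x S.* f) ((u S.* g) S.* f)) ⟨
      S.1# S.+ ((S.- (const x S.* f)) S.+ (S.- ((u S.* g) S.* f)))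
        ≈⟨ +-assocˢ S.1# _ _ ⟨
      u -ˢ ((u S.* g) S.* f)
        ≈⟨ +-congˡˢ {x = u} (-‿congˢ (*-assocˢ u g f)) ⟩
      u -ˢ (u S.* (g S.* f))
        ≈⟨ +-congʳˢ {x = S.- (u S.* (g S.* f))} (*-identityʳˢ u) ⟨
      (u S.* S.1#) -ˢ (u S.* (g S.* f))
        ≈⟨ P.x[y-z]≈xy-xz u S.1# (g S.* f) ⟨
      u S.* (S.1# -ˢ (g S.* f)) ∎
      where open ≈-Reasoning setoidˢ

    1-gf∼0 : ∀ n → S.1# -ˢ (approx n S.* f) ∼[ n ] S.0#
    1-gf∼0 zero    = mk∼ λ _ ()
    1-gf∼0 (suc n) = mk∼ λ d d<n →
      trans (step (approx n) d) (at (*-vanish {u = u} u₀≈0 (1-gf∼0 n)) d d<n)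

  -- The carrier stays the full series and only the equality is coarsened, so series need not be
  -- truncated and the general ring lemmas apply to congruences.
  mod : ℕ → Ring c ℓ
  mod n = coarsen series {_∼[ n ]_}
    (record
      { refl  = mk∼ λ _ _ → ≈-refl
      ; sym   = λ e → mk∼ λ d d<n → sym (at e d d<n)
      ; trans = λ e e′ → mk∼ λ d d<n → trans (at e d d<n) (at e′ d d<n)
      })
    (λ e → mk∼ λ d _ → e d)
    (λ e e′ → mk∼ λ d d<n → +-cong (at e d d<n) (at e′ d d<n))
    *-cong-mod
    (λ e → mk∼ λ d d<n → -‿cong (at e d d<n))

  ∼-weaken : ∀ {m n f g} → m ℕ.≤ n → f ∼[ n ] g → f ∼[ m ] g
  ∼-weaken m≤n f∼g = mk∼ λ d d<m → at f∼g d (ℕ.<-≤-trans d<m m≤n)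

  shift : ℕ → S.Carrier → S.Carrier
  shift zero    f         = f
  shift (suc m) f zero    = 0#
  shift (suc m) f (suc d) = shift m f d

  shift-+ : ∀ m f g d → shift m (f S.+ g) d ≈ (shift m f S.+ shift m g) d
  shift-+ zero    f g d       = ≈-refl
  shift-+ (suc m) f g zero    = sym (+-identityʳ 0#)
  shift-+ (suc m) f g (suc d) = shift-+ m f g d

  shift-*ˡ : ∀ m f g d → (shift m f S.* g) d ≈ shift m (f S.* g) d
  shift-*ˡ zero    f g d       = ≈-refl
  shift-*ˡ (suc m) f g zero    = trans (+-identityʳ (0# * g 0)) (zeroˡ (g 0))
  shift-*ˡ (suc m) f g (suc d) = trans
    (+-cong (zeroˡ (g (suc d))) (shift-*ˡ m f g d))
    (+-identityˡ (shift m (f S.* g) d))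

  shift-*ʳ : ∀ m f g d → (f S.* shift m g) d ≈ shift m (f S.* g) d
  shift-*ʳ zero    f g d       = ≈-refl
  shift-*ʳ (suc m) f g zero    = trans (+-identityʳ (f 0 * 0#)) (zeroʳ (f 0))
  shift-*ʳ (suc m) f g (suc d) = trans
    (conv-last (f ⊗ shift (suc m) g) d)
    (trans (+-cong (shift-*ʳ m f g d) (zeroʳ (f (suc d))))
           (+-identityʳ (shift m (f S.* g) d)))

  shift-coefficient : ∀ m f d → shift m f (m ℕ.+ d) ≡ f d
  shift-coefficient zero    f d = refl
  shift-coefficient (suc m) f d = shift-coefficient m f d

  shift-cong : ∀ m {n f g} → f ∼[ n ] g → shift m f ∼[ m ℕ.+ n ] shift m g
  shift-cong m {n} {f} {g} f∼g = mk∼ (go m)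
    where
    go : ∀ m d → d ℕ.< m ℕ.+ n → shift m f d ≈ shift m g d
    go zero    d       d<n          = at f∼g d d<n
    go (suc m) zero    _            = ≈-refl
    go (suc m) (suc d) (ℕ.s≤s d<m+n) = go m d d<m+n

  -- Division by t^m: coefficient m + d of a shifted series is coefficient d of the series.
  shift-cancel : ∀ m {n f g} → shift m f ∼[ m ℕ.+ n ] shift m g → f ∼[ n ] g
  shift-cancel m {n} {f} {g} e = mk∼ λ d d<n → trans
    (reflexive (≡.sym (shift-coefficient m f d)))
    (trans (at e (m ℕ.+ d) (ℕ.+-monoʳ-< m d<n)) (reflexive (shift-coefficient m g d)))

  shift-0 : ∀ m d → shift m S.0# d ≈ 0#
  shift-0 zero    d       = ≈-refl
  shift-0 (suc m) zero    = ≈-refl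
  shift-0 (suc m) (suc d) = shift-0 m d

  shift-unshift : ∀ m f → f ∼[ m ] S.0# → ∀ d → shift m (λ d → f (m ℕ.+ d)) d ≈ f d
  shift-unshift zero    f f∼0 d       = ≈-refl
  shift-unshift (suc m) f f∼0 zero    = sym (at f∼0 0 (ℕ.s≤s ℕ.z≤n))
  shift-unshift (suc m) f f∼0 (suc d) = shift-unshift m (f ∘ suc)
    (mk∼ λ d d<m → at f∼0 (suc d) (ℕ.s≤s d<m)) d

  shift-shift∼0 : ∀ m f → shift m (shift m f) ∼[ m ℕ.+ m ] S.0#
  shift-shift∼0 m f = mk∼ λ d d<2m →
    trans (at (shift-cong m {m} {shift m f} {S.0#} (mk∼ (vanish m))) d d<2m) (shift-0 m d)
    where
    vanish : ∀ m d → d ℕ.< m → shift m f d ≈ 0#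
    vanish (suc m) zero    _            = ≈-refl
    vanish (suc m) (suc d) (ℕ.s≤s d<m) = vanish m d d<m

  -- Multiplication of dual numbers, with t^m as the infinitesimal. The ring is not commutative, so
  -- the factors keep their order.
  *-first-order : ∀ {m n} → n ℕ.≤ m → ∀ f f′ g g′ →
    (f S.+ shift m f′) S.* (g S.+ shift m g′)
      ∼[ m ℕ.+ n ] (f S.* g) S.+ shift m ((f′ S.* g) S.+ (f S.* g′))
  *-first-order {m} {n} n≤m f f′ g g′ = begin
    (f S.+ F′) S.* (g S.+ G′)
      ≈⟨ T.distribʳ (g S.+ G′) f F′ ⟩
    (f S.* (g S.+ G′)) S.+ (F′ S.* (g S.+ G′))
      ≈⟨ T.+-cong (T.distribˡ f g G′) (T.distribˡ F′ g G′) ⟩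
    ((f S.* g) S.+ (f S.* G′)) S.+ ((F′ S.* g) S.+ (F′ S.* G′))
      ≈⟨ T.+-congˡ (T.+-congˡ F′G′∼0) ⟩
    ((f S.* g) S.+ (f S.* G′)) S.+ ((F′ S.* g) S.+ S.0#)
      ≈⟨ T.+-congˡ (T.+-identityʳ (F′ S.* g)) ⟩
    ((f S.* g) S.+ (f S.* G′)) S.+ (F′ S.* g)
      ≈⟨ T.+-assoc (f S.* g) (f S.* G′) (F′ S.* g) ⟩
    (f S.* g) S.+ ((f S.* G′) S.+ (F′ S.* g))
      ≈⟨ T.+-congˡ (T.+-comm (f S.* G′) (F′ S.* g)) ⟩
    (f S.* g) S.+ ((F′ S.* g) S.+ (f S.* G′))
      ≈⟨ T.+-congˡ (T.+-cong (mk∼ λ d _ → shift-*ˡ m f′ g d) (mk∼ λ d _ → shift-*ʳ m f g′ d)) ⟩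
    (f S.* g) S.+ (shift m (f′ S.* g) S.+ shift m (f S.* g′))
      ≈⟨ T.+-congˡ (mk∼ λ d _ → shift-+ m (f′ S.* g) (f S.* g′) d) ⟨
    (f S.* g) S.+ shift m ((f′ S.* g) S.+ (f S.* g′)) ∎
    where
    module T = Ring (mod (m ℕ.+ n))
    open ≈-Reasoning T.setoid
    F′ G′ : S.Carrier
    F′ = shift m f′
    G′ = shift m g′

    F′G′∼0 : F′ S.* G′ ∼[ m ℕ.+ n ] S.0#
    F′G′∼0 = begin
      F′ S.* G′
        ≈⟨ mk∼ (λ d _ → shift-*ˡ m f′ G′ d) ⟩
      shift m (f′ S.* G′)
        ≈⟨ shift-cong m (mk∼ λ d _ → shift-*ʳ m f′ g′ d) ⟩
      shift m (shift m (f′ S.* g′))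
        ≈⟨ ∼-weaken (ℕ.+-monoʳ-≤ m n≤m) (shift-shift∼0 m (f′ S.* g′)) ⟩
      S.0# ∎

-- Units in local rings and the matching of distinct elements.

injective⇒hits : ∀ {n} {f : Fin n → Fin n} → Injective _≡_ _≡_ f → ∀ k → ∃ λ i → f i ≡ k
injective⇒hits {suc n} {f} inj k with Fin.any? (λ i → f i Fin.≟ k)
... | yes hit = hit
-- A missed `k` can be punched out of the codomain, which leaves an injection of `Fin (suc n)` into
-- `Fin n`.
... | no miss = contradiction
  (Fin.injective⇒≤ {f = λ i → punchOut (k≢f i)}
    (λ {i} {j} → inj ∘ Fin.punchOut-injective (k≢f i) (k≢f j)))
  ℕ.1+n≰n
  where
  k≢f : ∀ i → k ≢ f i
  k≢f i k≡fi = miss (i , ≡.sym k≡fi)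

module Units {c ℓ} (R : CommutativeRing c ℓ) where
  open CommutativeRing R hiding (zero) renaming (refl to ≈-refl)
  open SemiringSum semiring using (sum)

  Unit : Carrier → Set (c ⊔ ℓ)
  Unit x = ∃ λ y → x * y ≈ 1#

  -- The constructive form of having a unique maximal ideal. For the reals it does the work of
  -- deciding whether a number is zero.
  IsLocal : Set (c ⊔ ℓ)
  IsLocal = ¬ (0# ≈ 1#) × (∀ x y → x + y ≈ 1# → Unit x ⊎ Unit y)

  -- The double sum is the squared Frobenius norm of a matrix, the shape in which sums of squares
  -- occur below.
  IsFormallyReal : Set (c ⊔ ℓ)
  IsFormallyReal = ∀ m n (t : Fin m → Fin n → Carrier) →
    sum (λ i → sum (λ j → t i j * t i j)) ≈ 0# → ∀ i j → t i j ≈ 0#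

  unit-resp : ∀ {x y} → x ≈ y → Unit x → Unit y
  unit-resp x≈y (z , xz≈1) = z , trans (*-congʳ (sym x≈y)) xz≈1

  unit-factorˡ : ∀ x y → Unit (x * y) → Unit x
  unit-factorˡ x y (z , xyz≈1) = y * z , trans (sym (*-assoc x y z)) xyz≈1

  unit-factorʳ : ∀ x y → Unit (x * y) → Unit y
  unit-factorʳ x y = unit-factorˡ y x ∘ unit-resp (*-comm x y)

  unit-cancelʳ : ∀ x y z → Unit z → x * z ≈ y * z → x ≈ y
  unit-cancelʳ x y z (w , zw≈1) xz≈yz = begin
    x                ≈⟨ *-identityʳ x ⟨
    x * 1#           ≈⟨ *-congˡ zw≈1 ⟨
    x * (z * w)      ≈⟨ *-assoc x z w ⟨
    (x * z) * w      ≈⟨ *-congʳ xz≈yz ⟩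
    (y * z) * w      ≈⟨ *-assoc y z w ⟩
    y * (z * w)      ≈⟨ *-congˡ zw≈1 ⟩
    y * 1#           ≈⟨ *-identityʳ y ⟩
    y                ∎
    where open ≈-Reasoning setoid

  module _ (local : IsLocal) where
    0-nonunit : ¬ Unit 0#
    0-nonunit (z , 0z≈1) = proj₁ local (trans (sym (zeroˡ z)) 0z≈1)

    -- The inverse `z` scales the sum to 1, so locality applies to the scaled head and tail; a
    -- factor of a unit is again a unit.
    unit-sum : ∀ {n} (t : Fin n → Carrier) → Unit (sum t) → ∃ λ k → Unit (t k)
    unit-sum {zero}  t u = contradiction u 0-nonunit
    unit-sum {suc n} t (z , sz≈1) =
      [ (λ u → zero , unit-factorˡ _ z u)
      , (λ u → let k , uₖ = unit-sum (t ∘ suc) (unit-factorˡ _ z u) in suc k , uₖ) ]′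
      (proj₂ local _ _ (trans (sym (distribʳ z (t zero) (sum (t ∘ suc)))) sz≈1))

    -- Equal labels would make two of the `y` equal, so `σ` is injective and hence hits every index.
    -- Each `x k` is thus some `y i`, and different `k` come from different `i`.
    separated-by-labels : ∀ {n} (x y : Fin n → Carrier) (σ : Fin n → Fin n) →
      (∀ i j → i ≢ j → Unit (y i - y j)) → (∀ j → x (σ j) ≈ y j) →
      ∀ k l → k ≢ l → Unit (x k - x l)
    separated-by-labels x y σ y-distinct xσ≈y k l k≢l =
      separate (injective⇒hits σ-injective k) (injective⇒hits σ-injective l)
      where
      σ-injective : Injective _≡_ _≡_ σ
      σ-injective {i} {j} σi≡σj with i Fin.≟ j
      ... | yes i≡j = i≡j
      ... | no i≢j = contradiction
        (unit-resp (trans (+-congʳ yi≈yj) (-‿inverseʳ (y j))) (y-distinct i j i≢j))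
        0-nonunit
        where
        yi≈yj : y i ≈ y j
        yi≈yj = trans (sym (xσ≈y i)) (trans (reflexive (cong x σi≡σj)) (xσ≈y j))

      separate : (∃ λ i → σ i ≡ k) → (∃ λ j → σ j ≡ l) → Unit (x k - x l)
      separate (i , refl) (j , refl) = unit-resp
        (+-cong (sym (xσ≈y i)) (-‿cong (sym (xσ≈y j))))
        (y-distinct i j (k≢l ∘ cong σ))

-- Orthogonal diagonalisation over a local, formally real ring.

module Diagonalisation {c ℓ} (R : CommutativeRing c ℓ)
  (local : Units.IsLocal R) (formally-real : Units.IsFormallyReal R) (N : ℕ) where
  open CommutativeRing R hiding (zero) renaming (refl to ≈-refl)
  open SemiringSum semiring
  open Units R
  open MatrixRing ring N
  private module M = Ring matrix
  open RingProperties matrix using ([y-z]x≈yx-zx; x[y-z]≈xy-xz)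

  transpose : M.Carrier → M.Carrier
  transpose X i j = X j i

  trace : M.Carrier → Carrier
  trace X = sum (λ i → X i i)

  trace-cong : ∀ {X Y} → X M.≈ Y → trace X ≈ trace Y
  trace-cong X≈Y = sum-cong-≋ (λ i → X≈Y i i)

  trace-comm : ∀ X Y → trace (X M.* Y) ≈ trace (Y M.* X)
  trace-comm X Y = trans (∑-comm (λ i k → X i k * Y k i))
    (sum-cong-≋ λ k → sum-cong-≋ λ i → *-comm (X i k) (Y k i))

  symmetric-idempotent-traceless : ∀ P → transpose P M.≈ P → P M.* P M.≈ P →
    trace P ≈ 0# → P M.≈ M.0#
  symmetric-idempotent-traceless P Pᵀ≈P P²≈P tr≈0 = formally-real N N P (begin
    sum (λ i → sum (λ j → P i j * P i j))
      ≈⟨ sum-cong-≋ (λ i → sum-cong-≋ (λ j → *-congˡ (Pᵀ≈P i j))) ⟨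
    trace (P M.* P)
      ≈⟨ trace-cong P²≈P ⟩
    trace P
      ≈⟨ tr≈0 ⟩
    0# ∎)
    where open ≈-Reasoning setoid

  1-symmetric : transpose M.1# M.≈ M.1#
  1-symmetric i j = by-cases (i Fin.≟ j)
    where
    by-cases : Dec (i ≡ j) → M.1# j i ≈ M.1# i j
    by-cases (yes refl) = ≈-refl
    by-cases (no i≢j)   = reflexive
      (≡.trans (δ-off-diagonal (i≢j ∘ ≡.sym)) (≡.sym (δ-off-diagonal i≢j)))

  left-orthogonal⇒right-orthogonal : ∀ Q → transpose Q M.* Q M.≈ M.1# →
    Q M.* transpose Q M.≈ M.1#
  left-orthogonal⇒right-orthogonal Q QᵀQ≈1 = M.sym (x∙y⁻¹≈ε⇒x≈y M.1# E
    (symmetric-idempotent-traceless P P-symmetric P-idempotent P-traceless))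
    where
    open RingProperties matrix using (x∙y⁻¹≈ε⇒x≈y; -0#≈0#)
    open ≈-Reasoning M.setoid
    E P : M.Carrier
    E = Q M.* transpose Q
    P = M.1# M.- E

    P-symmetric : transpose P M.≈ P
    P-symmetric i j = +-cong (1-symmetric i j)
      (-‿cong (sum-cong-≋ λ k → *-comm (Q j k) (Q i k)))

    E-idempotent : E M.* E M.≈ E
    E-idempotent = begin
      (Q M.* transpose Q) M.* (Q M.* transpose Q)
        ≈⟨ M.*-assoc Q (transpose Q) E ⟩
      Q M.* (transpose Q M.* (Q M.* transpose Q))
        ≈⟨ M.*-congˡ {Q} (M.*-assoc (transpose Q) Q (transpose Q)) ⟨
      Q M.* ((transpose Q M.* Q) M.* transpose Q)
        ≈⟨ M.*-congˡ {Q} (M.*-congʳ {transpose Q} QᵀQ≈1) ⟩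
      Q M.* (M.1# M.* transpose Q)
        ≈⟨ M.*-congˡ {Q} (M.*-identityˡ (transpose Q)) ⟩
      Q M.* transpose Q ∎

    EP≈0 : E M.* P M.≈ M.0#
    EP≈0 = begin
      E M.* P                        ≈⟨ x[y-z]≈xy-xz E M.1# E ⟩
      (E M.* M.1#) M.- (E M.* E)     ≈⟨ M.+-cong (M.*-identityʳ E) (M.-‿cong E-idempotent) ⟩
      E M.- E                        ≈⟨ M.-‿inverseʳ E ⟩
      M.0#                           ∎

    P-idempotent : P M.* P M.≈ P
    P-idempotent = begin
      P M.* P                        ≈⟨ [y-z]x≈yx-zx P M.1# E ⟩
      (M.1# M.* P) M.- (E M.* P)     ≈⟨ M.+-cong (M.*-identityˡ P) (M.-‿cong EP≈0) ⟩
      P M.- M.0#                     ≈⟨ M.+-congˡ {P} -0#≈0# ⟩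
      P M.+ M.0#                     ≈⟨ M.+-identityʳ P ⟩
      P                              ∎

    -- Here P + E = I, and trace I = trace (Qᵀ Q) = trace (Q Qᵀ) = trace E, so trace P cancels to 0
    -- without evaluating the trace of the identity.
    P-traceless : trace P ≈ 0#
    P-traceless = RingProperties.+-identityˡ-unique ring (trace P) (trace E) (trans
      (sym (∑-distrib-+ (λ i → P i i) (λ i → E i i)))
      (trans
        (trace-cong {P M.+ E} {M.1#} (M.trans (M.+-assoc M.1# (M.- E) E)
          (M.trans (M.+-congˡ {M.1#} (M.-‿inverseˡ E)) (M.+-identityʳ M.1#))))
        (trans (trace-cong (M.sym QᵀQ≈1)) (trace-comm (transpose Q) Q))))

  -- W = Qᵀ V satisfies Q W = V and Λ W = W diag μ, so an invertible entry W k j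
  -- forces λ k = μ j.
  diagonal-separated : ∀ A Q Λ →
    (transpose Q M.* A) M.* Q M.≈ Λ → transpose Q M.* Q M.≈ M.1# →
    (∀ i j → i ≢ j → Λ i j ≈ 0#) →
    (μ : Fin N → Carrier) (V : M.Carrier) →
    (∀ i j → i ≢ j → Unit (μ i - μ j)) →
    (∀ i j → (A M.* V) i j ≈ μ j * V i j) →
    (∀ j → ∃ λ i → Unit (V i j)) →
    ∀ k l → k ≢ l → Unit (Λ k k - Λ l l)
  diagonal-separated A Q Λ QᵀAQ≈Λ QᵀQ≈1 Λ-diagonal μ V μ-distinct AV≈Vμ V-unit k l k≢l =
    separated-by-labels local (λ i → Λ i i) μ (λ j → proj₁ (W-unit j)) μ-distinct
      (λ j → let i , u = W-unit j in unit-cancelʳ (Λ i i) (μ j) (W i j) u (λW≈μW i j))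
      k l k≢l
    where
    W : M.Carrier
    W = transpose Q M.* V

    QW≈V : Q M.* W M.≈ V
    QW≈V = begin
      Q M.* (transpose Q M.* V)    ≈⟨ M.*-assoc Q (transpose Q) V ⟨
      (Q M.* transpose Q) M.* V    ≈⟨ M.*-congʳ {V} (left-orthogonal⇒right-orthogonal Q QᵀQ≈1) ⟩
      M.1# M.* V                   ≈⟨ M.*-identityˡ V ⟩
      V                            ∎
      where open ≈-Reasoning M.setoid

    ΛW≈QᵀAV : Λ M.* W M.≈ transpose Q M.* (A M.* V)
    ΛW≈QᵀAV = begin
      Λ M.* W                              ≈⟨ M.*-congʳ {W} QᵀAQ≈Λ ⟨
      ((transpose Q M.* A) M.* Q) M.* W    ≈⟨ M.*-assoc (transpose Q M.* A) Q W ⟩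
      (transpose Q M.* A) M.* (Q M.* W)    ≈⟨ M.*-congˡ {transpose Q M.* A} QW≈V ⟩
      (transpose Q M.* A) M.* V            ≈⟨ M.*-assoc (transpose Q) A V ⟩
      transpose Q M.* (A M.* V)            ∎
      where open ≈-Reasoning M.setoid

    λW≈μW : ∀ i j → Λ i i * W i j ≈ μ j * W i j
    λW≈μW i j = begin
      Λ i i * W i j
        ≈⟨ *-diagonalˡ Λ W Λ-diagonal i j ⟨
      (Λ M.* W) i j
        ≈⟨ ΛW≈QᵀAV i j ⟩
      sum (λ m → Q m i * (A M.* V) m j)
        ≈⟨ sum-cong-≋ (λ m → *-congˡ {Q m i} (AV≈Vμ m j)) ⟩
      sum (λ m → Q m i * (μ j * V m j))
        ≈⟨ sum-cong-≋ (λ m → x∙yz≈y∙xz (Q m i) (μ j) (V m j)) ⟩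
      sum (λ m → μ j * (Q m i * V m j))
        ≈⟨ *-distribˡ-sum (μ j) (λ m → Q m i * V m j) ⟨
      μ j * W i j ∎
      where
      open ≈-Reasoning setoid
      open CommutativeSemigroupProperties *-commutativeSemigroup using (x∙yz≈y∙xz)

    -- An invertible entry `V m j` is the sum of the `Q m i * W i j`, so one of these terms is
    -- invertible, and with it its factor `W i j`.
    W-unit : ∀ j → ∃ λ i → Unit (W i j)
    W-unit j =
      let m , v-unit = V-unit j
          i , u = unit-sum local (λ i → Q m i * W i j) (unit-resp (sym (QW≈V m j)) v-unit)
      in i , unit-factorʳ (Q m i) (W i j) u

-- Power series with matrix coefficients: entries, transposition and diagonal series.

module MatrixSeries {c ℓ} (R : CommutativeRing c ℓ) (N : ℕ) where
  open CommutativeRing R hiding (zero) renaming (refl to ≈-refl)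
  open SemiringSum semiring using (sum; sum-cong-≋)
  open MatrixRing ring N public
  module M = Ring matrix
  module MS = SeriesRing matrix
  module SS = SeriesRing ring
  -- X and x hold the operations of Defs on matrix series and on scalar series.
  module X = RawRing (seriesRing (matrixRing rawRing N))
  module x = RawRing (seriesRing rawRing)
  open MS using (_∼[_]_; mk∼; at)

  infix 9 _ᵀ
  _ᵀ : X.Carrier → X.Carrier
  (A ᵀ) d i j = A d j i

  entry : X.Carrier → Fin N → Fin N → x.Carrier
  entry A i j d = A d i j

  infixl 7 _⊙_
  _⊙_ : X.Carrier → X.Carrier → X.Carrier
  (A ⊙ B) d i j = (entry A i j x.* entry B i j) d

  infixr 7 _·_
  _·_ : Carrier → X.Carrier → X.Carrier
  (a · A) d i j = a * A d i j

  entrywise : ∀ {n A B} → (∀ i j → entry A i j SS.∼[ n ] entry B i j) → A ∼[ n ] B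
  entrywise e = mk∼ λ d d<n i j → SS.at (e i j) d d<n

  entry-cong : ∀ {n A B} → A ∼[ n ] B → ∀ i j → entry A i j SS.∼[ n ] entry B i j
  entry-cong A∼B i j = SS.mk∼ λ d d<n → at A∼B d d<n i j

  conv-entry : ∀ h d i j → MS.conv h d i j ≡ SS.conv (λ a b → h a b i j) d
  conv-entry h d i j = sum-entry {suc d} (λ k → h (toℕ k) (d ∸ toℕ k)) i j

  ᵀ-cong : ∀ {n A B} → A ∼[ n ] B → A ᵀ ∼[ n ] B ᵀ
  ᵀ-cong A∼B = mk∼ λ d d<n i j → at A∼B d d<n j i

  -- Commuting the scalar factors exchanges the matrices in each term, which leaves the two
  -- convolution indices exchanged as well; `conv-flip` restores their order.
  ᵀ-* : ∀ A B d → ((A X.* B) ᵀ) d M.≈ (B ᵀ X.* A ᵀ) d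
  ᵀ-* A B d i j = begin
    (A X.* B) d j i
      ≡⟨ conv-entry (MS._⊗_ A B) d j i ⟩
    SS.conv (λ a b → sum (λ k → A a j k * B b k i)) d
      ≈⟨ SS.conv-cong _ _ d (λ a b → sum-cong-≋ λ k → *-comm (A a j k) (B b k i)) ⟩
    SS.conv (λ a b → sum (λ k → B b k i * A a j k)) d
      ≈⟨ SS.conv-flip (λ a b → sum (λ k → B b k i * A a j k)) d ⟩
    SS.conv (λ a b → sum (λ k → B a k i * A b j k)) d
      ≡⟨ conv-entry (MS._⊗_ (B ᵀ) (A ᵀ)) d i j ⟨
    (B ᵀ X.* A ᵀ) d i j ∎
    where open ≈-Reasoning setoid

  ᵀ-shift : ∀ m A d → (MS.shift m A ᵀ) d M.≈ MS.shift m (A ᵀ) d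
  ᵀ-shift zero    A d       i j = ≈-refl
  ᵀ-shift (suc m) A zero    i j = ≈-refl
  ᵀ-shift (suc m) A (suc d) i j = ᵀ-shift m A d i j

  -- The name refers to matrix congruence, the passage from A to Bᵀ A B. It serves both the residual
  -- built from `A` and the term of `K` built from `ΔA`.
  congruence-symmetric : ∀ {n} B A → A ᵀ ∼[ n ] A → (B ᵀ X.* A X.* B) ᵀ ∼[ n ] B ᵀ X.* A X.* B
  congruence-symmetric {n} B A Aᵀ∼A = begin
    (B ᵀ X.* A X.* B) ᵀ          ≈⟨ mk∼ (λ d _ → ᵀ-* (B ᵀ X.* A) B d) ⟩
    B ᵀ X.* (B ᵀ X.* A) ᵀ        ≈⟨ T.*-congˡ {B ᵀ} (mk∼ λ d _ → ᵀ-* (B ᵀ) A d) ⟩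
    B ᵀ X.* (A ᵀ X.* B)          ≈⟨ T.*-congˡ {B ᵀ} (T.*-congʳ {B} Aᵀ∼A) ⟩
    B ᵀ X.* (A X.* B)            ≈⟨ T.*-assoc (B ᵀ) A B ⟨
    (B ᵀ X.* A) X.* B            ∎
    where
    module T = Ring (MS.mod n)
    open ≈-Reasoning T.setoid

  Diagonal : X.Carrier → Set ℓ
  Diagonal A = ∀ d i j → i ≢ j → A d i j ≈ 0#

  diagonal-symmetric : ∀ {n A} → Diagonal A → A ᵀ ∼[ n ] A
  diagonal-symmetric {A = A} diag = mk∼ λ d _ i j → by-cases d (i Fin.≟ j)
    where
    by-cases : ∀ d {i j} → Dec (i ≡ j) → A d j i ≈ A d i j
    by-cases d (yes refl)          = ≈-refl
    by-cases d {i} {j} (no i≢j) = trans (diag d j i (i≢j ∘ ≡.sym)) (sym (diag d i j i≢j))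

  *-diagonalˡ-entry : ∀ Λ B → Diagonal Λ → ∀ i j d →
    (Λ X.* B) d i j ≈ (entry Λ i i x.* entry B i j) d
  *-diagonalˡ-entry Λ B diag i j d = trans
    (reflexive (conv-entry (MS._⊗_ Λ B) d i j))
    (SS.conv-cong _ _ d λ a b → *-diagonalˡ (Λ a) (B b) (diag a) i j)

  *-diagonalʳ-entry : ∀ B Λ → Diagonal Λ → ∀ i j d →
    (B X.* Λ) d i j ≈ (entry B i j x.* entry Λ j j) d
  *-diagonalʳ-entry B Λ diag i j d = trans
    (reflexive (conv-entry (MS._⊗_ B Λ) d i j))
    (SS.conv-cong _ _ d λ a b → *-diagonalʳ (B a) (Λ b) (diag b) i j)

  1-diagonal : Diagonal X.1#
  1-diagonal zero    i j i≢j = reflexive (δ-off-diagonal i≢j)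
  1-diagonal (suc d) i j i≢j = ≈-refl

  1⊙-diagonal : ∀ A i d → (X.1# ⊙ A) d i i ≈ entry A i i d
  1⊙-diagonal A i d = trans
    (SS.conv-cong (entry X.1# i i SS.⊗ entry A i i) (x.1# SS.⊗ entry A i i) d
      λ { zero b → *-congʳ (reflexive (δ-diagonal i)) ; (suc a) b → ≈-refl })
    (SS.*-identityˡˢ (entry A i i) d)

  1⊙-off-diagonal : ∀ A → Diagonal (X.1# ⊙ A)
  1⊙-off-diagonal A d i j i≢j = SS.conv-0 (entry X.1# i j SS.⊗ entry A i j) d λ a b _ _ →
    trans (*-congʳ (1-diagonal a i j i≢j)) (zeroˡ (A b i j))

  *-commˢ : ∀ f g d → (f x.* g) d ≈ (g x.* f) d
  *-commˢ f g d = trans (SS.conv-flip (f SS.⊗ g) d)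
    (SS.conv-cong _ _ d λ a b → *-comm (f b) (g a))

  -- Correctness of the update, to first order in t^D.

  module UpdateStep (D E : ℕ) (E≤D : E ℕ.≤ D) (-½ : Carrier) (-½-½≈-1 : -½ + -½ ≈ - 1#)
    (A ΔA Q Λ Q′ Λ′ ΔF ΔG S K ΔΛ H ΔQ : X.Carrier)
    (Q′∼Q : Q′ ∼[ E ] Q) (Λ′∼Λ : Λ′ ∼[ E ] Λ)
    (Aᵀ∼A : A ᵀ ∼[ D ℕ.+ E ] A) (ΔAᵀ∼ΔA : ΔA ᵀ ∼[ E ] ΔA)
    (QᵀAQ∼Λ : Q ᵀ X.* A X.* Q ∼[ D ] Λ) (QᵀQ∼1 : Q ᵀ X.* Q ∼[ D ] X.1#)
    (Λ-diagonal : Diagonal Λ)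
    (ΔF-eq : MS.shift D ΔF ∼[ D ℕ.+ E ] Q ᵀ X.* A X.* Q X.+ X.- Λ)
    (ΔG-eq : MS.shift D ΔG ∼[ D ℕ.+ E ] Q ᵀ X.* Q X.+ X.- X.1#)
    (S-eq : S ∼[ E ] -½ · ΔG)
    (K-eq : K ∼[ E ] ΔF X.+ Q′ ᵀ X.* ΔA X.* Q′ X.+ S X.* Λ′ X.+ Λ′ X.* S)
    (ΔΛ-eq : ΔΛ ∼[ E ] X.1# ⊙ K)
    (H-off : ∀ i j → i ≢ j →
      entry H i j x.* (entry Λ′ j j x.+ x.- entry Λ′ i i) SS.∼[ E ] x.1#)
    (H-diag : ∀ i → entry H i i SS.∼[ E ] x.0#)
    (ΔQ-eq : ΔQ ∼[ E ] Q′ X.* (H ⊙ (K X.+ X.- ΔΛ) X.+ S))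
    where

    private
      module T  = Ring (MS.mod E)
      module T′ = Ring (MS.mod (D ℕ.+ E))
      module t  = Ring (SS.mod E)
      module TP = RingProperties (MS.mod E)
      module tP = RingProperties (SS.mod E)
      open MS using (shift; shift-cong; shift-cancel; ∼-weaken)

    P G B : X.Carrier
    P = K X.+ X.- ΔΛ
    G = H ⊙ P
    B = Q ᵀ X.* ΔA X.* Q

    t-*-comm : ∀ f g → f x.* g SS.∼[ E ] g x.* f
    t-*-comm f g = SS.mk∼ λ d _ → *-commˢ f g d

    -- Modulo t^E the truncations `Q′` and `Λ′` may be replaced by `Q` and `Λ`, so that the
    -- decomposition known for the latter becomes applicable.
    K∼ : K ∼[ E ] ((ΔF X.+ B) X.+ S X.* Λ) X.+ Λ X.* S
    K∼ = T.trans K-eq (T.+-cong (T.+-cong (T.+-congˡ {ΔF}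
      (T.*-cong (T.*-congʳ {ΔA} (ᵀ-cong Q′∼Q)) Q′∼Q)) (T.*-congˡ {S} Λ′∼Λ)) (T.*-congʳ {S} Λ′∼Λ))

    Λᵀ∼Λ : ∀ {n} → Λ ᵀ ∼[ n ] Λ
    Λᵀ∼Λ = diagonal-symmetric {A = Λ} Λ-diagonal

    -- The symmetry of `ΔF` and `ΔG` is inherited from the residuals that they divide: transposition
    -- acts on each coefficient and so commutes with division by t^D.
    unshift-symmetric : ∀ Z W → shift D Z ∼[ D ℕ.+ E ] W → W ᵀ ∼[ D ℕ.+ E ] W → Z ᵀ ∼[ E ] Z
    unshift-symmetric Z W Z∼W Wᵀ∼W = shift-cancel D (begin
      shift D (Z ᵀ)    ≈⟨ mk∼ (λ d _ → ᵀ-shift D Z d) ⟨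
      (shift D Z) ᵀ    ≈⟨ ᵀ-cong Z∼W ⟩
      W ᵀ              ≈⟨ Wᵀ∼W ⟩
      W                ≈⟨ Z∼W ⟨
      shift D Z        ∎)
      where open ≈-Reasoning T′.setoid

    ΔFᵀ∼ΔF : ΔF ᵀ ∼[ E ] ΔF
    ΔFᵀ∼ΔF = unshift-symmetric ΔF (Q ᵀ X.* A X.* Q X.+ X.- Λ) ΔF-eq
      (T′.+-cong (congruence-symmetric Q A Aᵀ∼A) (T′.-‿cong Λᵀ∼Λ))

    ΔGᵀ∼ΔG : ΔG ᵀ ∼[ E ] ΔG
    ΔGᵀ∼ΔG = unshift-symmetric ΔG (Q ᵀ X.* Q X.+ X.- X.1#) ΔG-eq
      (T′.+-cong (mk∼ λ d _ → ᵀ-* (Q ᵀ) Q d)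
                 (T′.-‿cong (diagonal-symmetric {A = X.1#} 1-diagonal)))

    Sᵀ∼S : S ᵀ ∼[ E ] S
    Sᵀ∼S = begin
      S ᵀ                ≈⟨ ᵀ-cong S-eq ⟩
      -½ · (ΔG ᵀ)        ≈⟨ mk∼ (λ d d<E i j → *-congˡ (at ΔGᵀ∼ΔG d d<E i j)) ⟩
      -½ · ΔG            ≈⟨ S-eq ⟨
      S                  ∎
      where open ≈-Reasoning T.setoid

    -- Transposition exchanges `S X.* Λ` with `Λ X.* S` and fixes `ΔF` and `B`.
    Kᵀ∼K : K ᵀ ∼[ E ] K
    Kᵀ∼K = begin
      K ᵀ
        ≈⟨ ᵀ-cong K∼ ⟩
      ((ΔF ᵀ X.+ B ᵀ) X.+ (S X.* Λ) ᵀ) X.+ (Λ X.* S) ᵀ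
        ≈⟨ T.+-cong (T.+-cong (T.+-cong ΔFᵀ∼ΔF (congruence-symmetric Q ΔA ΔAᵀ∼ΔA))
             (T.trans (mk∼ λ d _ → ᵀ-* S Λ d) (T.*-cong Λᵀ∼Λ Sᵀ∼S)))
             (T.trans (mk∼ λ d _ → ᵀ-* Λ S d) (T.*-cong Sᵀ∼S Λᵀ∼Λ)) ⟩
      ((ΔF X.+ B) X.+ Λ X.* S) X.+ S X.* Λ
        ≈⟨ T.+-assoc (ΔF X.+ B) (Λ X.* S) (S X.* Λ) ⟩
      (ΔF X.+ B) X.+ (Λ X.* S X.+ S X.* Λ)
        ≈⟨ T.+-congˡ {ΔF X.+ B} (T.+-comm (Λ X.* S) (S X.* Λ)) ⟩
      (ΔF X.+ B) X.+ (S X.* Λ X.+ Λ X.* S)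
        ≈⟨ T.+-assoc (ΔF X.+ B) (S X.* Λ) (Λ X.* S) ⟨
      ((ΔF X.+ B) X.+ S X.* Λ) X.+ Λ X.* S
        ≈⟨ K∼ ⟨
      K ∎
      where open ≈-Reasoning T.setoid

    ΔΛ-off-diagonal : ∀ d → d ℕ.< E → ∀ i j → i ≢ j → ΔΛ d i j ≈ 0#
    ΔΛ-off-diagonal d d<E i j i≢j = trans (at ΔΛ-eq d d<E i j) (1⊙-off-diagonal K d i j i≢j)

    ΔΛᵀ∼ΔΛ : ΔΛ ᵀ ∼[ E ] ΔΛ
    ΔΛᵀ∼ΔΛ = T.trans (ᵀ-cong ΔΛ-eq) (T.trans
      (diagonal-symmetric {A = X.1# ⊙ K} (1⊙-off-diagonal K)) (T.sym ΔΛ-eq))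

    P-symmetric : ∀ i j → entry P j i SS.∼[ E ] entry P i j
    P-symmetric = entry-cong (T.+-cong Kᵀ∼K (T.-‿cong ΔΛᵀ∼ΔΛ))

    gap : Fin N → Fin N → x.Carrier
    gap i j = entry Λ j j x.+ x.- entry Λ i i

    H*gap∼1 : ∀ i j → i ≢ j → entry H i j x.* gap i j SS.∼[ E ] x.1#
    H*gap∼1 i j i≢j = t.trans
      (t.*-congˡ {entry H i j} (t.+-cong (entry-cong (T.sym Λ′∼Λ) j j)
        (t.-‿cong (entry-cong (T.sym Λ′∼Λ) i i))))
      (H-off i j i≢j)

    -- H i j and − H j i are both inverses of λ j − λ i.
    H-antisymmetric : ∀ i j → i ≢ j → entry H i j SS.∼[ E ] x.- entry H j i
    H-antisymmetric i j i≢j = begin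
      h                          ≈⟨ t.*-identityʳ h ⟨
      h x.* x.1#                 ≈⟨ t.*-congˡ {h} gh′∼1 ⟨
      h x.* (g x.* (x.- h′))     ≈⟨ t.*-assoc h g (x.- h′) ⟨
      (h x.* g) x.* (x.- h′)     ≈⟨ t.*-congʳ {x.- h′} (H*gap∼1 i j i≢j) ⟩
      x.1# x.* (x.- h′)          ≈⟨ t.*-identityˡ (x.- h′) ⟩
      x.- h′                     ∎
      where
      open ≈-Reasoning t.setoid
      h h′ g : x.Carrier
      h = entry H i j
      h′ = entry H j i
      g = gap i j

      gh′∼1 : g x.* (x.- h′) SS.∼[ E ] x.1#
      gh′∼1 = begin
        g x.* (x.- h′)         ≈⟨ tP.-‿distribʳ-* g h′ ⟨
        x.- (g x.* h′)         ≈⟨ tP.-‿distribˡ-* g h′ ⟩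
        (x.- g) x.* h′         ≈⟨ t-*-comm (x.- g) h′ ⟩
        h′ x.* (x.- g)         ≈⟨ t.*-congˡ {h′} (tP.⁻¹-anti-homo‿- (entry Λ j j) (entry Λ i i)) ⟩
        h′ x.* gap j i         ≈⟨ H*gap∼1 j i (i≢j ∘ ≡.sym) ⟩
        x.1#                   ∎

    -- Off the diagonal an antisymmetric factor `H` meets a symmetric factor `P`; on the diagonal
    -- `H` vanishes by definition.
    G+Gᵀ∼0 : G X.+ G ᵀ ∼[ E ] X.0#
    G+Gᵀ∼0 = entrywise λ i j → by-cases (i Fin.≟ j)
      where
      open ≈-Reasoning t.setoid
      by-cases : ∀ {i j} → Dec (i ≡ j) →
        (entry H i j x.* entry P i j) x.+ (entry H j i x.* entry P j i) SS.∼[ E ] x.0#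
      by-cases {i} {j} (yes refl) = t.trans (t.+-cong h*p∼0 h*p∼0) (t.+-identityʳ x.0#)
        where
        h*p∼0 : entry H i i x.* entry P i i SS.∼[ E ] x.0#
        h*p∼0 = t.trans (t.*-congʳ {entry P i i} (H-diag i)) (t.zeroˡ (entry P i i))
      by-cases {i} {j} (no i≢j) = begin
        (entry H i j x.* p) x.+ (h′ x.* entry P j i)
          ≈⟨ t.+-cong (t.*-congʳ {p} (H-antisymmetric i j i≢j)) (t.*-congˡ {h′} (P-symmetric i j)) ⟩
        ((x.- h′) x.* p) x.+ (h′ x.* p)
          ≈⟨ t.distribʳ p (x.- h′) h′ ⟨
        ((x.- h′) x.+ h′) x.* p
          ≈⟨ t.*-congʳ {p} (t.-‿inverseˡ h′) ⟩
        x.0# x.* p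
          ≈⟨ t.zeroˡ p ⟩
        x.0# ∎
        where
        h′ p : x.Carrier
        h′ = entry H j i
        p = entry P i j

    Gᵀ∼-G : G ᵀ ∼[ E ] X.- G
    Gᵀ∼-G = TP.+-inverseʳ-unique G (G ᵀ) G+Gᵀ∼0

    -- Off the diagonal, λ i G i j − G i j λ j = − (H i j (λ j − λ i)) P i j = − P i j.
    commutator : K X.+ (Λ X.* G X.+ X.- (G X.* Λ)) ∼[ E ] ΔΛ
    commutator = entrywise λ i j → t.trans
      (t.+-congˡ {entry K i j} (t.+-cong
        (SS.mk∼ λ d _ → *-diagonalˡ-entry Λ G Λ-diagonal i j d)
        (t.-‿cong (SS.mk∼ λ d _ → *-diagonalʳ-entry G Λ Λ-diagonal i j d))))
      (by-cases (i Fin.≟ j))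
      where
      open ≈-Reasoning t.setoid
      by-cases : ∀ {i j} → Dec (i ≡ j) →
        entry K i j x.+ ((entry Λ i i x.* entry G i j) x.+ x.- (entry G i j x.* entry Λ j j))
          SS.∼[ E ] entry ΔΛ i j
      -- On the diagonal the commutator vanishes, because scalar series commute, and what remains is
      -- the diagonal of `K`, which is that of `ΔΛ`.
      by-cases {i} (yes refl) = begin
        k x.+ ((l x.* g) x.+ x.- (g x.* l))
          ≈⟨ t.+-congˡ {k} (t.+-congʳ {x.- (g x.* l)} (t-*-comm l g)) ⟩
        k x.+ ((g x.* l) x.+ x.- (g x.* l))
          ≈⟨ t.+-congˡ {k} (t.-‿inverseʳ (g x.* l)) ⟩
        k x.+ x.0#
          ≈⟨ t.+-identityʳ k ⟩
        k
          ≈⟨ SS.mk∼ (λ d _ → 1⊙-diagonal K i d) ⟨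
        entry (X.1# ⊙ K) i i
          ≈⟨ entry-cong ΔΛ-eq i i ⟨
        entry ΔΛ i i ∎
        where
        k l g : x.Carrier
        k = entry K i i
        l = entry Λ i i
        g = entry G i i
      by-cases {i} {j} (no i≢j) = begin
        k x.+ ((lᵢ x.* g) x.+ x.- (g x.* lⱼ))
          ≈⟨ t.+-congˡ {k} (t.+-congʳ {x.- (g x.* lⱼ)} (t-*-comm lᵢ g)) ⟩
        k x.+ ((g x.* lᵢ) x.+ x.- (g x.* lⱼ))
          ≈⟨ t.+-congˡ {k} (tP.⁻¹-anti-homo‿- (g x.* lⱼ) (g x.* lᵢ)) ⟨
        k x.+ x.- ((g x.* lⱼ) x.+ x.- (g x.* lᵢ))
          ≈⟨ t.+-congˡ {k} (t.-‿cong (tP.x[y-z]≈xy-xz g lⱼ lᵢ)) ⟨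
        k x.+ x.- ((h x.* p) x.* gap i j)
          ≈⟨ t.+-congˡ {k} (t.-‿cong hpg∼p) ⟩
        k x.+ x.- (k x.+ x.- m)
          ≈⟨ t.+-congˡ {k} (tP.⁻¹-anti-homo‿- k m) ⟩
        k x.+ (m x.+ x.- k)
          ≈⟨ t.+-assoc k m (x.- k) ⟨
        (k x.+ m) x.+ x.- k
          ≈⟨ tP.xyx⁻¹≈y k m ⟩
        m ∎
        where
        k lᵢ lⱼ h p m g : x.Carrier
        k = entry K i j
        lᵢ = entry Λ i i
        lⱼ = entry Λ j j
        h = entry H i j
        p = entry P i j
        m = entry ΔΛ i j
        g = entry G i j

        hpg∼p : (h x.* p) x.* gap i j SS.∼[ E ] p
        hpg∼p = begin
          (h x.* p) x.* gap i j     ≈⟨ t.*-assoc h p (gap i j) ⟩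
          h x.* (p x.* gap i j)     ≈⟨ t.*-congˡ {h} (t-*-comm p (gap i j)) ⟩
          h x.* (gap i j x.* p)     ≈⟨ t.*-assoc h (gap i j) p ⟨
          (h x.* gap i j) x.* p     ≈⟨ t.*-congʳ {p} (H*gap∼1 i j i≢j) ⟩
          x.1# x.* p                ≈⟨ t.*-identityˡ p ⟩
          p                         ∎

    ΔQ∼ : ΔQ ∼[ E ] Q X.* (G X.+ S)
    ΔQ∼ = T.trans ΔQ-eq (T.*-congʳ {G X.+ S} Q′∼Q)

    [G+S]ᵀ∼S-G : (G X.+ S) ᵀ ∼[ E ] X.- G X.+ S
    [G+S]ᵀ∼S-G = T.+-cong Gᵀ∼-G Sᵀ∼S

    -- Orthogonality is available modulo t^D only. This suffices, as the product will be multiplied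
    -- by t^D and so matters only modulo t^E, where E ≤ D.
    QᵀΔQ∼G+S : Q ᵀ X.* ΔQ ∼[ E ] G X.+ S
    QᵀΔQ∼G+S = begin
      Q ᵀ X.* ΔQ                    ≈⟨ T.*-congˡ {Q ᵀ} ΔQ∼ ⟩
      Q ᵀ X.* (Q X.* (G X.+ S))     ≈⟨ T.*-assoc (Q ᵀ) Q (G X.+ S) ⟨
      (Q ᵀ X.* Q) X.* (G X.+ S)     ≈⟨ T.*-congʳ {G X.+ S} (∼-weaken E≤D QᵀQ∼1) ⟩
      X.1# X.* (G X.+ S)            ≈⟨ T.*-identityˡ (G X.+ S) ⟩
      G X.+ S                       ∎
      where open ≈-Reasoning T.setoid

    QᵀAΔQ∼Λ[G+S] : (Q ᵀ X.* A) X.* ΔQ ∼[ E ] Λ X.* (G X.+ S)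
    QᵀAΔQ∼Λ[G+S] = begin
      (Q ᵀ X.* A) X.* ΔQ                   ≈⟨ T.*-congˡ {Q ᵀ X.* A} ΔQ∼ ⟩
      (Q ᵀ X.* A) X.* (Q X.* (G X.+ S))    ≈⟨ T.*-assoc (Q ᵀ X.* A) Q (G X.+ S) ⟨
      (Q ᵀ X.* A X.* Q) X.* (G X.+ S)      ≈⟨ T.*-congʳ {G X.+ S} (∼-weaken E≤D QᵀAQ∼Λ) ⟩
      Λ X.* (G X.+ S)                      ∎
      where open ≈-Reasoning T.setoid

    ΔQᵀQ∼S-G : ΔQ ᵀ X.* Q ∼[ E ] X.- G X.+ S
    ΔQᵀQ∼S-G = begin
      ΔQ ᵀ X.* Q         ≈⟨ mk∼ (λ d _ → ᵀ-* (Q ᵀ) ΔQ d) ⟨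
      (Q ᵀ X.* ΔQ) ᵀ     ≈⟨ ᵀ-cong QᵀΔQ∼G+S ⟩
      (G X.+ S) ᵀ        ≈⟨ [G+S]ᵀ∼S-G ⟩
      X.- G X.+ S        ∎
      where open ≈-Reasoning T.setoid

    -- The transpose of `QᵀAΔQ∼Λ[G+S]`, by the symmetry of `A` and `Λ`.
    ΔQᵀAQ∼[S-G]Λ : (ΔQ ᵀ X.* A) X.* Q ∼[ E ] (X.- G X.+ S) X.* Λ
    ΔQᵀAQ∼[S-G]Λ = begin
      (ΔQ ᵀ X.* A) X.* Q         ≈⟨ T.*-assoc (ΔQ ᵀ) A Q ⟩
      ΔQ ᵀ X.* (A X.* Q)         ≈⟨ T.*-congˡ {ΔQ ᵀ} (T.*-congʳ {Q} (∼-weaken (ℕ.m≤n+m E D) Aᵀ∼A)) ⟨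
      ΔQ ᵀ X.* (A ᵀ X.* Q)       ≈⟨ T.*-congˡ {ΔQ ᵀ} (mk∼ λ d _ → ᵀ-* (Q ᵀ) A d) ⟨
      ΔQ ᵀ X.* (Q ᵀ X.* A) ᵀ     ≈⟨ mk∼ (λ d _ → ᵀ-* (Q ᵀ X.* A) ΔQ d) ⟨
      ((Q ᵀ X.* A) X.* ΔQ) ᵀ     ≈⟨ ᵀ-cong QᵀAΔQ∼Λ[G+S] ⟩
      (Λ X.* (G X.+ S)) ᵀ        ≈⟨ mk∼ (λ d _ → ᵀ-* Λ (G X.+ S) d) ⟩
      (G X.+ S) ᵀ X.* Λ ᵀ        ≈⟨ T.*-cong [G+S]ᵀ∼S-G Λᵀ∼Λ ⟩
      (X.- G X.+ S) X.* Λ        ∎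
      where open ≈-Reasoning T.setoid

    ΔG+2S∼0 : ΔG X.+ (S X.+ S) ∼[ E ] X.0#
    ΔG+2S∼0 = T.trans (T.+-congˡ {ΔG} (T.+-cong S-eq S-eq)) (mk∼ λ d _ i j →
      let g = ΔG d i j in begin
      g + (-½ * g + -½ * g)    ≈⟨ +-congˡ (distribʳ g -½ -½) ⟨
      g + (-½ + -½) * g        ≈⟨ +-congˡ (*-congʳ -½-½≈-1) ⟩
      g + - 1# * g             ≈⟨ +-congˡ (RingProperties.-1*x≈-x ring g) ⟩
      g + - g                  ≈⟨ -‿inverseʳ g ⟩
      0#                       ∎)
      where open ≈-Reasoning setoid

    orthogonality-increment : ΔG X.+ (ΔQ ᵀ X.* Q X.+ Q ᵀ X.* ΔQ) ∼[ E ] X.0#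
    orthogonality-increment = begin
      ΔG X.+ (ΔQ ᵀ X.* Q X.+ Q ᵀ X.* ΔQ)
        ≈⟨ T.+-congˡ {ΔG} (T.+-cong ΔQᵀQ∼S-G QᵀΔQ∼G+S) ⟩
      ΔG X.+ ((X.- G X.+ S) X.+ (G X.+ S))
        ≈⟨ T.+-congˡ {ΔG} (solve 3 (λ n s g → (n ⊕ s) ⊕ (g ⊕ s) ⊜ (n ⊕ g) ⊕ (s ⊕ s)) T.refl (X.- G) S G) ⟩
      ΔG X.+ ((X.- G X.+ G) X.+ (S X.+ S))
        ≈⟨ T.+-congˡ {ΔG} (T.+-congʳ {S X.+ S} (T.-‿inverseˡ G)) ⟩
      ΔG X.+ (X.0# X.+ (S X.+ S))
        ≈⟨ T.+-congˡ {ΔG} (T.+-identityˡ (S X.+ S)) ⟩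
      ΔG X.+ (S X.+ S)
        ≈⟨ ΔG+2S∼0 ⟩
      X.0# ∎
      where
      open ≈-Reasoning T.setoid
      open CommutativeMonoidSolver T.+-commutativeMonoid

    -- The part `S` of Qᵀ ΔQ contributes exactly the terms `S X.* Λ` and `Λ X.* S` built into `K`;
    -- the part `G` contributes the commutator with `Λ`.
    diagonalisation-increment :
      ΔF X.+ ((ΔQ ᵀ X.* A X.+ Q ᵀ X.* ΔA) X.* Q X.+ Q ᵀ X.* A X.* ΔQ) ∼[ E ] ΔΛ
    diagonalisation-increment = begin
      ΔF X.+ ((ΔQ ᵀ X.* A X.+ Q ᵀ X.* ΔA) X.* Q X.+ Q ᵀ X.* A X.* ΔQ)
        ≈⟨ T.+-congˡ {ΔF} (T.+-congʳ {Q ᵀ X.* A X.* ΔQ} (T.distribʳ Q (ΔQ ᵀ X.* A) (Q ᵀ X.* ΔA))) ⟩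
      ΔF X.+ (((ΔQ ᵀ X.* A) X.* Q X.+ B) X.+ Q ᵀ X.* A X.* ΔQ)
        ≈⟨ T.+-congˡ {ΔF} (T.+-cong (T.+-congʳ {B} (T.trans ΔQᵀAQ∼[S-G]Λ [S-G]Λ))
             (T.trans QᵀAΔQ∼Λ[G+S] (T.distribˡ Λ G S))) ⟩
      ΔF X.+ (((X.- (G X.* Λ) X.+ S X.* Λ) X.+ B) X.+ (Λ X.* G X.+ Λ X.* S))
        ≈⟨ solve 6 (λ f n s b l r → f ⊕ (((n ⊕ s) ⊕ b) ⊕ (l ⊕ r)) ⊜ (((f ⊕ b) ⊕ s) ⊕ r) ⊕ (l ⊕ n))
             T.refl ΔF (X.- (G X.* Λ)) (S X.* Λ) B (Λ X.* G) (Λ X.* S) ⟩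
      (((ΔF X.+ B) X.+ S X.* Λ) X.+ Λ X.* S) X.+ (Λ X.* G X.+ X.- (G X.* Λ))
        ≈⟨ T.+-congʳ {Λ X.* G X.+ X.- (G X.* Λ)} K∼ ⟨
      K X.+ (Λ X.* G X.+ X.- (G X.* Λ))
        ≈⟨ commutator ⟩
      ΔΛ ∎
      where
      open ≈-Reasoning T.setoid
      open CommutativeMonoidSolver T.+-commutativeMonoid

      [S-G]Λ : (X.- G X.+ S) X.* Λ ∼[ E ] X.- (G X.* Λ) X.+ S X.* Λ
      [S-G]Λ = T.trans (T.distribʳ Λ (X.- G) S)
        (T.+-congʳ {S X.* Λ} (T.sym (TP.-‿distribˡ-* G Λ)))

    Q̃ Ã : X.Carrier
    Q̃ = Q X.+ shift D ΔQ
    Ã = A X.+ shift D ΔA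

    Q̃ᵀ∼ : Q̃ ᵀ ∼[ D ℕ.+ E ] Q ᵀ X.+ shift D (ΔQ ᵀ)
    Q̃ᵀ∼ = T′.+-congˡ {Q ᵀ} (mk∼ λ d _ → ᵀ-shift D ΔQ d)

    -- `Y` is an unperturbed product, `Z` its intended value and `ΔY` the defect divided by t^D,
    -- which here joins the first-order term `W`.
    absorb : ∀ {Y Z ΔY} W → shift D ΔY ∼[ D ℕ.+ E ] Y X.+ X.- Z →
      Y X.+ shift D W ∼[ D ℕ.+ E ] Z X.+ shift D (ΔY X.+ W)
    absorb {Y} {Z} {ΔY} W ΔY-eq = begin
      Y X.+ shift D W
        ≈⟨ T′.+-congʳ {shift D W} (RingProperties.//-rightDividesˡ (MS.mod (D ℕ.+ E)) Z Y) ⟨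
      ((Y X.+ X.- Z) X.+ Z) X.+ shift D W
        ≈⟨ T′.+-congʳ {shift D W} (T′.+-comm (Y X.+ X.- Z) Z) ⟩
      (Z X.+ (Y X.+ X.- Z)) X.+ shift D W
        ≈⟨ T′.+-congʳ {shift D W} (T′.+-congˡ {Z} ΔY-eq) ⟨
      (Z X.+ shift D ΔY) X.+ shift D W
        ≈⟨ T′.+-assoc Z (shift D ΔY) (shift D W) ⟩
      Z X.+ (shift D ΔY X.+ shift D W)
        ≈⟨ T′.+-congˡ {Z} (mk∼ λ d _ → MS.shift-+ D ΔY W d) ⟨
      Z X.+ shift D (ΔY X.+ W) ∎
      where open ≈-Reasoning T′.setoid

    update-orthogonal : Q̃ ᵀ X.* Q̃ ∼[ D ℕ.+ E ] X.1#
    update-orthogonal = begin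
      Q̃ ᵀ X.* Q̃
        ≈⟨ T′.*-congʳ {Q̃} Q̃ᵀ∼ ⟩
      (Q ᵀ X.+ shift D (ΔQ ᵀ)) X.* Q̃
        ≈⟨ MS.*-first-order E≤D (Q ᵀ) (ΔQ ᵀ) Q ΔQ ⟩
      Q ᵀ X.* Q X.+ shift D (ΔQ ᵀ X.* Q X.+ Q ᵀ X.* ΔQ)
        ≈⟨ absorb (ΔQ ᵀ X.* Q X.+ Q ᵀ X.* ΔQ) ΔG-eq ⟩
      X.1# X.+ shift D (ΔG X.+ (ΔQ ᵀ X.* Q X.+ Q ᵀ X.* ΔQ))
        ≈⟨ T′.+-congˡ {X.1#} (shift-cong D orthogonality-increment) ⟩
      X.1# X.+ shift D X.0#
        ≈⟨ T′.+-congˡ {X.1#} (mk∼ λ d _ → MS.shift-0 D d) ⟩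
      X.1# X.+ X.0#
        ≈⟨ T′.+-identityʳ X.1# ⟩
      X.1# ∎
      where open ≈-Reasoning T′.setoid

    update-diagonalises : Q̃ ᵀ X.* Ã X.* Q̃ ∼[ D ℕ.+ E ] Λ X.+ shift D ΔΛ
    update-diagonalises = begin
      Q̃ ᵀ X.* Ã X.* Q̃
        ≈⟨ T′.*-congʳ {Q̃} (T′.trans (T′.*-congʳ {Ã} Q̃ᵀ∼) (MS.*-first-order E≤D (Q ᵀ) (ΔQ ᵀ) A ΔA)) ⟩
      (Q ᵀ X.* A X.+ shift D (ΔQ ᵀ X.* A X.+ Q ᵀ X.* ΔA)) X.* Q̃
        ≈⟨ MS.*-first-order E≤D (Q ᵀ X.* A) (ΔQ ᵀ X.* A X.+ Q ᵀ X.* ΔA) Q ΔQ ⟩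
      Q ᵀ X.* A X.* Q X.+ shift D W
        ≈⟨ absorb W ΔF-eq ⟩
      Λ X.+ shift D (ΔF X.+ W)
        ≈⟨ T′.+-congˡ {Λ} (shift-cong D diagonalisation-increment) ⟩
      Λ X.+ shift D ΔΛ ∎
      where
      open ≈-Reasoning T′.setoid
      W : X.Carrier
      W = (ΔQ ᵀ X.* A X.+ Q ᵀ X.* ΔA) X.* Q X.+ Q ᵀ X.* A X.* ΔQ

-- Null sequences of rationals

IsNull : (ℕ → ℚ) → Set
IsNull z = ∀ ε → 0ℚ ℚ.< ε → ∃ λ M → ∀ n → M ℕ.≤ n → ∣ z n ∣ ℚ.< ε

IsBounded : (ℕ → ℚ) → Set
IsBounded z = ∃ λ M → ∃ λ B → 0ℚ ℚ.< B × (∀ n → M ℕ.≤ n → ∣ z n ∣ ℚ.≤ B)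

EventuallyPositive : (ℕ → ℚ) → Set
EventuallyPositive z = ∃ λ M → ∃ λ δ → 0ℚ ℚ.< δ × (∀ n → M ℕ.≤ n → δ ℚ.≤ z n)

abstract
  half-positive : ∀ {ε} → 0ℚ ℚ.< ε → 0ℚ ℚ.< ½ ℚ.* ε
  half-positive {ε} 0<ε =
    subst (ℚ._< ½ ℚ.* ε) (ℚ.*-zeroʳ ½) (ℚ.*-monoʳ-<-pos ½ 0<ε)

  halves : ∀ ε → ½ ℚ.* ε ℚ.+ ½ ℚ.* ε ≡ ε
  halves = solve 1 (λ e → con ½ :* e :+ con ½ :* e := e) refl
    where open +-*-Solver

  *-positive : ∀ {p q} → 0ℚ ℚ.< p → 0ℚ ℚ.< q → 0ℚ ℚ.< p ℚ.* q
  *-positive {p} {q} 0<p 0<q =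
    subst (ℚ._< p ℚ.* q) (ℚ.*-zeroʳ p) (ℚ.*-monoʳ-<-pos p {{ℚ.positive 0<p}} 0<q)

  positive-inverse : ∀ B → 0ℚ ℚ.< B → ∃ λ C → 0ℚ ℚ.< C × B ℚ.* C ≡ 1ℚ
  positive-inverse B 0<B =
    1/ B , ℚ.positive⁻¹ (1/ B) {{ℚ.1/pos⇒pos B}} , ℚ.*-inverseʳ B
    where
    instance
      B-positive : ℚ.Positive B
      B-positive = ℚ.positive 0<B
      B-nonZero : ℚ.NonZero B
      B-nonZero = ℚ.pos⇒nonZero B

  +-cancelʳ-< : ∀ r {p q} → p ℚ.+ r ℚ.< q ℚ.+ r → p ℚ.< q
  +-cancelʳ-< r {p} {q} p+r<q+r = begin-strict
    p                  ≡⟨ solve 2 (λ p r → p := (p :+ r) :- r) refl p r ⟩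
    (p ℚ.+ r) ℚ.- r    <⟨ ℚ.+-monoˡ-< (ℚ.- r) p+r<q+r ⟩
    (q ℚ.+ r) ℚ.- r    ≡⟨ solve 2 (λ q r → (q :+ r) :- r := q) refl q r ⟩
    q                  ∎
    where
    open ℚ.≤-Reasoning
    open +-*-Solver

  p-q<ε⇒p<q+ε : ∀ p q {ε} → ∣ p ℚ.- q ∣ ℚ.< ε → p ℚ.< q ℚ.+ ε
  p-q<ε⇒p<q+ε p q {ε} close = begin-strict
    p                       ≡⟨ solve 2 (λ p q → p := q :+ (p :- q)) refl p q ⟩
    q ℚ.+ (p ℚ.- q)         ≤⟨ ℚ.+-monoʳ-≤ q (p≤∣p∣ (p ℚ.- q)) ⟩
    q ℚ.+ ∣ p ℚ.- q ∣       <⟨ ℚ.+-monoʳ-< q close ⟩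
    q ℚ.+ ε                 ∎
    where
    open ℚ.≤-Reasoning
    open +-*-Solver
    p≤∣p∣ : ∀ p → p ℚ.≤ ∣ p ∣
    p≤∣p∣ p with ℚ.≤-total 0ℚ p
    ... | inj₁ 0≤p = ℚ.≤-reflexive (≡.sym (ℚ.0≤p⇒∣p∣≡p 0≤p))
    ... | inj₂ p≤0 = ℚ.≤-trans p≤0 (ℚ.0≤∣p∣ p)

  null-0 : IsNull (λ _ → 0ℚ)
  null-0 ε 0<ε = 0 , λ _ _ → 0<ε

  null-resp : ∀ {y z} → (∀ n → y n ≡ z n) → IsNull y → IsNull z
  null-resp y≡z null ε 0<ε with null ε 0<ε
  ... | M , h = M , λ n p → subst (λ q → ∣ q ∣ ℚ.< ε) (y≡z n) (h n p)

  null-neg : ∀ {z} → IsNull z → IsNull (λ n → ℚ.- z n)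
  null-neg {z} null ε 0<ε with null ε 0<ε
  ... | M , h = M , λ n p →
    subst (ℚ._< ε) (≡.sym (ℚ.∣-p∣≡∣p∣ (z n))) (h n p)

  null-+ : ∀ {y z} → IsNull y → IsNull z → IsNull (λ n → y n ℚ.+ z n)
  null-+ {y} {z} null-y null-z ε 0<ε
    with null-y _ (half-positive 0<ε) | null-z _ (half-positive 0<ε)
  ... | M , h | M′ , h′ = M ℕ.⊔ M′ , λ n p → begin-strict
    ∣ y n ℚ.+ z n ∣        ≤⟨ ℚ.∣p+q∣≤∣p∣+∣q∣ (y n) (z n) ⟩
    ∣ y n ∣ ℚ.+ ∣ z n ∣    <⟨ ℚ.+-mono-< (h n (ℕ.m⊔n≤o⇒m≤o M M′ p))
                                         (h′ n (ℕ.m⊔n≤o⇒n≤o M M′ p)) ⟩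
    ½ ℚ.* ε ℚ.+ ½ ℚ.* ε    ≡⟨ halves ε ⟩
    ε                      ∎
    where open ℚ.≤-Reasoning

  null-* : ∀ {y z} → IsBounded y → IsNull z → IsNull (λ n → y n ℚ.* z n)
  null-* {y} {z} (M , B , 0<B , y≤B) null-z ε 0<ε
    with positive-inverse B 0<B
  ... | C , 0<C , BC≡1 with null-z (C ℚ.* ε) (*-positive 0<C 0<ε)
  ... | M′ , h = M ℕ.⊔ M′ , λ n p → begin-strict
    ∣ y n ℚ.* z n ∣
      ≡⟨ ℚ.∣p*q∣≡∣p∣*∣q∣ (y n) (z n) ⟩
    ∣ y n ∣ ℚ.* ∣ z n ∣
      ≤⟨ ℚ.*-monoʳ-≤-nonNeg ∣ z n ∣ {{ℚ.∣-∣-nonNeg (z n)}}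
           (y≤B n (ℕ.m⊔n≤o⇒m≤o M M′ p)) ⟩
    B ℚ.* ∣ z n ∣
      <⟨ ℚ.*-monoʳ-<-pos B {{ℚ.positive 0<B}} (h n (ℕ.m⊔n≤o⇒n≤o M M′ p)) ⟩
    B ℚ.* (C ℚ.* ε)
      ≡⟨ ℚ.*-assoc B C ε ⟨
    (B ℚ.* C) ℚ.* ε
      ≡⟨ cong (ℚ._* ε) BC≡1 ⟩
    1ℚ ℚ.* ε
      ≡⟨ ℚ.*-identityˡ ε ⟩
    ε ∎
    where open ℚ.≤-Reasoning

  cauchy⇒bounded : ∀ {x} → Cauchy x → IsBounded x
  cauchy⇒bounded {x} cx with cx 1ℚ (ℚ.positive⁻¹ 1ℚ)
  ... | M , h = M , 1ℚ ℚ.+ ∣ x M ∣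
      , ℚ.+-mono-<-≤ (ℚ.positive⁻¹ 1ℚ) (ℚ.0≤∣p∣ (x M))
      , λ n p → begin
    ∣ x n ∣
      ≡⟨ cong ∣_∣ (solve 2 (λ a b → a := (a :- b) :+ b) refl (x n) (x M)) ⟩
    ∣ (x n ℚ.- x M) ℚ.+ x M ∣
      ≤⟨ ℚ.∣p+q∣≤∣p∣+∣q∣ (x n ℚ.- x M) (x M) ⟩
    ∣ x n ℚ.- x M ∣ ℚ.+ ∣ x M ∣
      ≤⟨ ℚ.+-monoˡ-≤ ∣ x M ∣ (ℚ.<⇒≤ (h n M p ℕ.≤-refl)) ⟩
    1ℚ ℚ.+ ∣ x M ∣ ∎
    where
    open ℚ.≤-Reasoning
    open +-*-Solver

-- The reals as a local and formally real ring

from-null : ∀ {x y} → IsNull (λ n → seq x n ℚ.- seq y n) → x ≈ᴿ y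
from-null = mk≈

to-null : ∀ {x y} → x ≈ᴿ y → IsNull (λ n → seq x n ℚ.- seq y n)
to-null = _≈ᴿ_.close

abstract
  pointwise : ∀ {x y} → (∀ n → seq x n ≡ seq y n) → x ≈ᴿ y
  pointwise {x} {y} x≡y = from-null (null-resp
    (λ n → ≡.sym (≡.trans (cong (ℚ._- seq y n) (x≡y n)) (ℚ.+-inverseʳ (seq y n))))
    null-0)

  ≈ᴿ-sym : ∀ {x y} → x ≈ᴿ y → y ≈ᴿ x
  ≈ᴿ-sym {x} {y} x≈y = from-null (null-resp
    (λ n → solve 2 (λ a b → :- (a :- b) := b :- a) refl (seq x n) (seq y n))
    (null-neg (to-null x≈y)))
    where open +-*-Solver

  ≈ᴿ-trans : ∀ {x y z} → x ≈ᴿ y → y ≈ᴿ z → x ≈ᴿ z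
  ≈ᴿ-trans {x} {y} {z} x≈y y≈z = from-null (null-resp
    (λ n → solve 3 (λ a b c → (a :- b) :+ (b :- c) := a :- c) refl
      (seq x n) (seq y n) (seq z n))
    (null-+ (to-null x≈y) (to-null y≈z)))
    where open +-*-Solver

  +ᴿ-cong : ∀ {x x′ y y′} → x ≈ᴿ x′ → y ≈ᴿ y′ → x +ᴿ y ≈ᴿ x′ +ᴿ y′
  +ᴿ-cong {x} {x′} {y} {y′} x≈x′ y≈y′ = from-null (null-resp
    (λ n → solve 4 (λ a a′ b b′ → (a :- a′) :+ (b :- b′) := (a :+ b) :- (a′ :+ b′)) refl
      (seq x n) (seq x′ n) (seq y n) (seq y′ n))
    (null-+ (to-null x≈x′) (to-null y≈y′)))
    where open +-*-Solver

  *ᴿ-cong : ∀ {x x′ y y′} → x ≈ᴿ x′ → y ≈ᴿ y′ → x *ᴿ y ≈ᴿ x′ *ᴿ y′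
  *ᴿ-cong {x} {x′} {y} {y′} x≈x′ y≈y′ = from-null (null-resp
    (λ n → solve 4
      (λ a a′ b b′ → a :* (b :- b′) :+ b′ :* (a :- a′) := a :* b :- a′ :* b′) refl
      (seq x n) (seq x′ n) (seq y n) (seq y′ n))
    (null-+ (null-* {seq x} (cauchy⇒bounded {seq x} (cauchy x)) (to-null y≈y′))
            (null-* {seq y′} (cauchy⇒bounded {seq y′} (cauchy y′)) (to-null x≈x′))))
    where open +-*-Solver

  -ᴿ-cong : ∀ {x y} → x ≈ᴿ y → -ᴿ x ≈ᴿ -ᴿ y
  -ᴿ-cong {x} {y} x≈y = from-null (null-resp
    (λ n → solve 2 (λ a b → :- (a :- b) := :- a :- (:- b)) refl (seq x n) (seq y n))
    (null-neg (to-null x≈y)))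
    where open +-*-Solver

ℝ-ring : CommutativeRing 0ℓ 0ℓ
ℝ-ring = record
  { _≈_ = _≈ᴿ_ ; _+_ = _+ᴿ_ ; _*_ = _*ᴿ_ ; -_ = -ᴿ_ ; 0# = 0ᴿ ; 1# = 1ᴿ
  ; isCommutativeRing = record
    { isRing = record
      { +-isAbelianGroup = record
        { isGroup = record
          { isMonoid = record
            { isSemigroup = record
              { isMagma = record
                { isEquivalence = record
                  { refl  = pointwise (λ _ → refl)
                  ; sym   = ≈ᴿ-sym
                  ; trans = ≈ᴿ-trans
                  }
                ; ∙-cong = +ᴿ-cong
                }
              ; assoc = λ x y z → pointwise λ n → ℚ.+-assoc (seq x n) (seq y n) (seq z n)
              }
            ; identity = (λ x → pointwise λ n → ℚ.+-identityˡ (seq x n))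
                       , (λ x → pointwise λ n → ℚ.+-identityʳ (seq x n))
            }
          ; inverse = (λ x → pointwise λ n → ℚ.+-inverseˡ (seq x n))
                    , (λ x → pointwise λ n → ℚ.+-inverseʳ (seq x n))
          ; ⁻¹-cong = -ᴿ-cong
          }
        ; comm = λ x y → pointwise λ n → ℚ.+-comm (seq x n) (seq y n)
        }
      ; *-cong = *ᴿ-cong
      ; *-assoc = λ x y z → pointwise λ n → ℚ.*-assoc (seq x n) (seq y n) (seq z n)
      ; *-identity = (λ x → pointwise λ n → ℚ.*-identityˡ (seq x n))
                   , (λ x → pointwise λ n → ℚ.*-identityʳ (seq x n))
      ; distrib = (λ x y z → pointwise λ n → ℚ.*-distribˡ-+ (seq x n) (seq y n) (seq z n))
                , (λ x y z → pointwise λ n → ℚ.*-distribʳ-+ (seq x n) (seq y n) (seq z n))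
      }
    ; *-comm = λ x y → pointwise λ n → ℚ.*-comm (seq x n) (seq y n)
    }
  }

0≉1 : ¬ (0ᴿ ≈ᴿ 1ᴿ)
0≉1 0≈1 with to-null 0≈1 ½ (ℚ.positive⁻¹ ½)
... | M , h = from-no (1ℚ ℚ.<? ½) (h M ℕ.≤-refl)

open Units ℝ-ring using (Unit; unit-resp)

positive⇒unit : ∀ x → EventuallyPositive (seq x) → Unit x
positive⇒unit (mkℝ x cx) (M , δ , 0<δ , δ≤x) = mkℝ y cy , from-null xy-1-null
  where
  -- An inverse is needed at every index, but `x n` is known to be at least `δ` only from `M` on.
  -- The maximum with `δ` is positive everywhere and leaves those later terms unchanged.
  x∨δ : ℕ → ℚ
  x∨δ n = x n ℚ.⊔ δ

  0<x∨δ : ∀ n → 0ℚ ℚ.< x∨δ n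
  0<x∨δ n = ℚ.<-≤-trans 0<δ (ℚ.p≤q⊔p (x n) δ)

  y : ℕ → ℚ
  y n = let z , _ = positive-inverse (x∨δ n) (0<x∨δ n) in z

  0<y : ∀ n → 0ℚ ℚ.< y n
  0<y n = let _ , 0<z , _ = positive-inverse (x∨δ n) (0<x∨δ n) in 0<z

  y-inverse : ∀ n → x∨δ n ℚ.* y n ≡ 1ℚ
  y-inverse n = let _ , _ , e = positive-inverse (x∨δ n) (0<x∨δ n) in e

  xy≡1 : ∀ n → M ℕ.≤ n → x n ℚ.* y n ≡ 1ℚ
  xy≡1 n p = ≡.trans (cong (ℚ._* y n) (≡.sym (ℚ.p≥q⇒p⊔q≡p (δ≤x n p)))) (y-inverse n)

  xy-1-null : IsNull (λ n → x n ℚ.* y n ℚ.- 1ℚ)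
  xy-1-null ε 0<ε = M , λ n p →
    subst (λ q → ∣ q ℚ.- 1ℚ ∣ ℚ.< ε) (≡.sym (xy≡1 n p)) 0<ε

  module _ {C} (0<C : 0ℚ ℚ.< C) (δC≡1 : δ ℚ.* C ≡ 1ℚ) where
    y≤C : ∀ n → y n ℚ.≤ C
    y≤C n = begin
      y n                        ≡⟨ ℚ.*-identityˡ (y n) ⟨
      1ℚ ℚ.* y n                 ≡⟨ cong (ℚ._* y n) δC≡1 ⟨
      (δ ℚ.* C) ℚ.* y n          ≡⟨ solve 3 (λ d c y → d :* c :* y := c :* y :* d) refl δ C (y n) ⟩
      C ℚ.* y n ℚ.* δ            ≤⟨ ℚ.*-monoˡ-≤-nonNeg (C ℚ.* y n)
                                      {{ℚ.nonNegative (ℚ.<⇒≤ (*-positive 0<C (0<y n)))}}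
                                      (ℚ.p≤q⊔p (x n) δ) ⟩
      C ℚ.* y n ℚ.* x∨δ n        ≡⟨ solve 3 (λ c y x → c :* y :* x := c :* (x :* y)) refl C (y n) (x∨δ n) ⟩
      C ℚ.* (x∨δ n ℚ.* y n)      ≡⟨ cong (C ℚ.*_) (y-inverse n) ⟩
      C ℚ.* 1ℚ                   ≡⟨ ℚ.*-identityʳ C ⟩
      C                          ∎
      where
      open ℚ.≤-Reasoning
      open +-*-Solver

    ∣y∣≤C : ∀ n → ∣ y n ∣ ℚ.≤ C
    ∣y∣≤C n = ℚ.≤-trans (ℚ.≤-reflexive (ℚ.0≤p⇒∣p∣≡p (ℚ.<⇒≤ (0<y n)))) (y≤C n)

    difference : ∀ m n → M ℕ.≤ m → M ℕ.≤ n →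
      y m ℚ.- y n ≡ (y m ℚ.* y n) ℚ.* (x n ℚ.- x m)
    difference m n p q = begin-equality
      y m ℚ.- y n
        ≡⟨ cong₂ ℚ._-_ (ℚ.*-identityʳ (y m)) (ℚ.*-identityʳ (y n)) ⟨
      y m ℚ.* 1ℚ ℚ.- y n ℚ.* 1ℚ
        ≡⟨ cong₂ (λ u v → y m ℚ.* u ℚ.- y n ℚ.* v) (xy≡1 n q) (xy≡1 m p) ⟨
      y m ℚ.* (x n ℚ.* y n) ℚ.- y n ℚ.* (x m ℚ.* y m)
        ≡⟨ solve 4 (λ a b c d → a :* (d :* b) :- b :* (c :* a) := (a :* b) :* (d :- c))
             refl (y m) (y n) (x m) (x n) ⟩
      (y m ℚ.* y n) ℚ.* (x n ℚ.- x m) ∎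
      where
      open ℚ.≤-Reasoning
      open +-*-Solver

    cy′ : Cauchy y
    -- The tolerance δ²ε is chosen because ∣y m - y n∣ ≤ C² ∣x n - x m∣ with C = 1/δ.
    cy′ ε 0<ε with cx (δ ℚ.* (δ ℚ.* ε)) (*-positive 0<δ (*-positive 0<δ 0<ε))
    ... | M′ , h = M ℕ.⊔ M′ , λ m n p q → begin-strict
      ∣ y m ℚ.- y n ∣
        ≡⟨ cong ∣_∣ (difference m n (ℕ.m⊔n≤o⇒m≤o M M′ p) (ℕ.m⊔n≤o⇒m≤o M M′ q)) ⟩
      ∣ (y m ℚ.* y n) ℚ.* (x n ℚ.- x m) ∣
        ≡⟨ ℚ.∣p*q∣≡∣p∣*∣q∣ (y m ℚ.* y n) (x n ℚ.- x m) ⟩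
      ∣ y m ℚ.* y n ∣ ℚ.* ∣ x n ℚ.- x m ∣
        ≡⟨ cong (ℚ._* ∣ x n ℚ.- x m ∣) (ℚ.∣p*q∣≡∣p∣*∣q∣ (y m) (y n)) ⟩
      (∣ y m ∣ ℚ.* ∣ y n ∣) ℚ.* ∣ x n ℚ.- x m ∣
        ≤⟨ ℚ.*-monoʳ-≤-nonNeg ∣ x n ℚ.- x m ∣ {{ℚ.∣-∣-nonNeg (x n ℚ.- x m)}}
             (ℚ.≤-trans
               (ℚ.*-monoʳ-≤-nonNeg ∣ y n ∣ {{ℚ.∣-∣-nonNeg (y n)}} (∣y∣≤C m))
               (ℚ.*-monoˡ-≤-nonNeg C {{ℚ.nonNegative (ℚ.<⇒≤ 0<C)}} (∣y∣≤C n))) ⟩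
      (C ℚ.* C) ℚ.* ∣ x n ℚ.- x m ∣
        <⟨ ℚ.*-monoʳ-<-pos (C ℚ.* C) {{ℚ.positive (*-positive 0<C 0<C)}}
             (h n m (ℕ.m⊔n≤o⇒n≤o M M′ q) (ℕ.m⊔n≤o⇒n≤o M M′ p)) ⟩
      (C ℚ.* C) ℚ.* (δ ℚ.* (δ ℚ.* ε))
        ≡⟨ solve 3 (λ c d e → (c :* c) :* (d :* (d :* e)) := (d :* c) :* ((d :* c) :* e))
             refl C δ ε ⟩
      (δ ℚ.* C) ℚ.* ((δ ℚ.* C) ℚ.* ε)
        ≡⟨ cong₂ (λ u v → u ℚ.* (v ℚ.* ε)) δC≡1 δC≡1 ⟩
      1ℚ ℚ.* (1ℚ ℚ.* ε)
        ≡⟨ ≡.trans (ℚ.*-identityˡ _) (ℚ.*-identityˡ ε) ⟩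
      ε ∎
      where
      open ℚ.≤-Reasoning
      open +-*-Solver

  cy : Cauchy y
  cy = let C , 0<C , δC≡1 = positive-inverse δ 0<δ in cy′ 0<C δC≡1

abstract
  <⇒positive : ∀ {x y} → x <ᴿ y → EventuallyPositive (seq (y +ᴿ -ᴿ x))
  <⇒positive {x} {y} (ε , 0<ε , M , h) = M , ε , 0<ε , λ n p → begin
    ε
      ≡⟨ solve 2 (λ x e → e := (x :+ e) :- x) refl (seq x n) ε ⟩
    (seq x n ℚ.+ ε) ℚ.- seq x n
      ≤⟨ ℚ.+-monoˡ-≤ (ℚ.- seq x n) (ℚ.<⇒≤ (h n p)) ⟩
    seq y n ℚ.- seq x n ∎
    where
    open ℚ.≤-Reasoning
    open +-*-Solver

  unit-flip : ∀ x y → Unit (y +ᴿ -ᴿ x) → Unit (x +ᴿ -ᴿ y)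
  unit-flip x y (z , inv) = -ᴿ z , ≈ᴿ-trans
    (pointwise λ n → solve 3 (λ x y z → (x :- y) :* (:- z) := (y :- x) :* z) refl
      (seq x n) (seq y n) (seq z n))
    inv
    where open +-*-Solver

  #⇒unit : ∀ {x y} → x # y → Unit (x +ᴿ -ᴿ y)
  #⇒unit {x} {y} (inj₂ y<x) = positive⇒unit (x +ᴿ -ᴿ y) (<⇒positive {y} {x} y<x)
  #⇒unit {x} {y} (inj₁ x<y) =
    unit-flip x y (positive⇒unit (y +ᴿ -ᴿ x) (<⇒positive {x} {y} x<y))

  -- Only positivity and 8e = 1 leave the `abstract` block, so ⅛ behaves as an opaque symbol in
  -- `local`.
  eighth : ∃ λ e → 0ℚ ℚ.< e ×
    1ℚ ≡ ((e ℚ.+ e) ℚ.+ (e ℚ.+ e)) ℚ.+ ((e ℚ.+ e) ℚ.+ (e ℚ.+ e))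
  eighth = ½ ℚ.* (½ ℚ.* ½) , ℚ.positive⁻¹ (½ ℚ.* (½ ℚ.* ½)) , refl

-- With e = ⅛ and N large, either x N ≥ 4e, and then x n > 3e for all n ≥ N, or
-- x N < 4e, and then x n < 5e and y n > 8e − e − 5e = 2e for all n ≥ N.
local : ∀ x y → x +ᴿ y ≈ᴿ 1ᴿ → Unit x ⊎ Unit y
local x y x+y≈1 = split (4e ℚ.≤? seq x N)
  where
  open ℚ.≤-Reasoning
  open +-*-Solver
  e : ℚ
  e = proj₁ eighth
  0<e : 0ℚ ℚ.< e
  0<e = proj₁ (proj₂ eighth)
  2e = e ℚ.+ e
  4e = 2e ℚ.+ 2e
  sum-close = to-null (≈ᴿ-sym x+y≈1) e 0<e
  x-close = cauchy x e 0<e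
  M = proj₁ sum-close
  M′ = proj₁ x-close
  N = M ℕ.⊔ M′

  0<2e : 0ℚ ℚ.< 2e
  0<2e = ℚ.+-mono-< 0<e 0<e

  split : Dec (4e ℚ.≤ seq x N) → Unit x ⊎ Unit y
  split (yes 4e≤x) = inj₁ (positive⇒unit x (N , 2e , 0<2e , λ n p →
    ℚ.<⇒≤ (+-cancelʳ-< e (begin-strict
      2e ℚ.+ e       <⟨ ℚ.+-monoʳ-< 2e (subst (ℚ._< 2e) (ℚ.+-identityʳ e) (ℚ.+-monoʳ-< e 0<e)) ⟩
      4e             ≤⟨ 4e≤x ⟩
      seq x N        <⟨ p-q<ε⇒p<q+ε (seq x N) (seq x n)
                          (proj₂ x-close N n (ℕ.m≤n⊔m M M′) (ℕ.m⊔n≤o⇒n≤o M M′ p)) ⟩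
      seq x n ℚ.+ e  ∎))))
  split (no 4e≰x) = inj₂ (positive⇒unit y (N , 2e , 0<2e , λ n p →
    ℚ.<⇒≤ (+-cancelʳ-< (4e ℚ.+ 2e) (begin-strict
      2e ℚ.+ (4e ℚ.+ 2e)
        ≡⟨ solve 1 (λ e → (e :+ e) :+ (((e :+ e) :+ (e :+ e)) :+ (e :+ e))
                       := ((e :+ e) :+ (e :+ e)) :+ ((e :+ e) :+ (e :+ e))) refl e ⟩
      4e ℚ.+ 4e
        ≡⟨ proj₂ (proj₂ eighth) ⟨
      1ℚ
        <⟨ p-q<ε⇒p<q+ε 1ℚ (seq x n ℚ.+ seq y n) (proj₂ sum-close n (ℕ.m⊔n≤o⇒m≤o M M′ p)) ⟩
      (seq x n ℚ.+ seq y n) ℚ.+ e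
        ≡⟨ solve 3 (λ x y e → x :+ y :+ e := x :+ (y :+ e)) refl (seq x n) (seq y n) e ⟩
      seq x n ℚ.+ (seq y n ℚ.+ e)
        <⟨ ℚ.+-monoˡ-< (seq y n ℚ.+ e) (p-q<ε⇒p<q+ε (seq x n) (seq x N)
             (proj₂ x-close n N (ℕ.m⊔n≤o⇒n≤o M M′ p) (ℕ.m≤n⊔m M M′))) ⟩
      (seq x N ℚ.+ e) ℚ.+ (seq y n ℚ.+ e)
        <⟨ ℚ.+-monoˡ-< (seq y n ℚ.+ e) (ℚ.+-monoˡ-< e (ℚ.≰⇒> 4e≰x)) ⟩
      (4e ℚ.+ e) ℚ.+ (seq y n ℚ.+ e)
        ≡⟨ solve 3 (λ f y e → (f :+ e) :+ (y :+ e) := y :+ (f :+ (e :+ e)))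
             refl 4e (seq y n) e ⟩
      seq y n ℚ.+ (4e ℚ.+ 2e) ∎))))

-- A property of the representing sequence, which equality of reals does not preserve. Sums of
-- squares satisfy it literally, and it makes estimates possible term by term.
PointwiseNonNegative : ℝ → Set
PointwiseNonNegative x = ∀ n → 0ℚ ℚ.≤ seq x n

abstract
  square-nonNegative : ∀ x → PointwiseNonNegative (x *ᴿ x)
  square-nonNegative x n with ℚ.≤-total 0ℚ (seq x n)
  ... | inj₁ 0≤p = subst (ℚ._≤ seq x n ℚ.* seq x n) (ℚ.*-zeroʳ (seq x n))
    (ℚ.*-monoˡ-≤-nonNeg (seq x n) {{ℚ.nonNegative 0≤p}} 0≤p)
  ... | inj₂ p≤0 = subst (ℚ._≤ seq x n ℚ.* seq x n) (ℚ.*-zeroʳ (seq x n))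
    (ℚ.*-monoˡ-≤-nonPos (seq x n) {{ℚ.nonPositive p≤0}} p≤0)

  +-nonNegative : ∀ x y → PointwiseNonNegative x → PointwiseNonNegative y →
    PointwiseNonNegative (x +ᴿ y)
  +-nonNegative x y 0≤x 0≤y n = ℚ.+-mono-≤ (0≤x n) (0≤y n)

  -- Term by term x is squeezed between 0 and x + y.
  summand≈0 : ∀ x y → PointwiseNonNegative x → PointwiseNonNegative y →
    x +ᴿ y ≈ᴿ 0ᴿ → x ≈ᴿ 0ᴿ
  summand≈0 x y 0≤x 0≤y x+y≈0 = from-null λ ε 0<ε →
    let M , h = to-null x+y≈0 ε 0<ε in M , λ n p → begin-strict
      ∣ seq x n ℚ.- 0ℚ ∣
        ≡⟨ cong ∣_∣ (ℚ.+-identityʳ (seq x n)) ⟩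
      ∣ seq x n ∣
        ≡⟨ ℚ.0≤p⇒∣p∣≡p (0≤x n) ⟩
      seq x n
        ≡⟨ ℚ.+-identityʳ (seq x n) ⟨
      seq x n ℚ.+ 0ℚ
        ≤⟨ ℚ.+-monoʳ-≤ (seq x n) (0≤y n) ⟩
      seq x n ℚ.+ seq y n
        ≡⟨ ℚ.0≤p⇒∣p∣≡p (+-nonNegative x y 0≤x 0≤y n) ⟨
      ∣ seq x n ℚ.+ seq y n ∣
        ≡⟨ cong ∣_∣ (ℚ.+-identityʳ (seq x n ℚ.+ seq y n)) ⟨
      ∣ seq x n ℚ.+ seq y n ℚ.- 0ℚ ∣
        <⟨ h n p ⟩
      ε ∎
    where open ℚ.≤-Reasoning

  -- For the tolerance ε the square is taken within ε²: ∣x n∣ ≥ ε would force ∣x n∣² ≥ ε².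
  square≈0 : ∀ x → x *ᴿ x ≈ᴿ 0ᴿ → x ≈ᴿ 0ᴿ
  square≈0 x x²≈0 = from-null λ ε 0<ε →
    let M , h = to-null x²≈0 (ε ℚ.* ε) (*-positive 0<ε 0<ε) in M , λ n p →
    subst (λ q → ∣ q ∣ ℚ.< ε) (≡.sym (ℚ.+-identityʳ (seq x n)))
      (ℚ.≰⇒> λ ε≤∣x∣ → ℚ.<-irrefl refl (ℚ.<-≤-trans (h n p) (begin
        ε ℚ.* ε
          ≤⟨ ℚ.*-monoʳ-≤-nonNeg ε {{ℚ.nonNegative (ℚ.<⇒≤ 0<ε)}} ε≤∣x∣ ⟩
        ∣ seq x n ∣ ℚ.* ε
          ≤⟨ ℚ.*-monoˡ-≤-nonNeg ∣ seq x n ∣ {{ℚ.∣-∣-nonNeg (seq x n)}} ε≤∣x∣ ⟩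
        ∣ seq x n ∣ ℚ.* ∣ seq x n ∣
          ≡⟨ ℚ.∣p*q∣≡∣p∣*∣q∣ (seq x n) (seq x n) ⟨
        ∣ seq x n ℚ.* seq x n ∣
          ≡⟨ cong ∣_∣ (ℚ.+-identityʳ (seq x n ℚ.* seq x n)) ⟨
        ∣ seq x n ℚ.* seq x n ℚ.- 0ℚ ∣ ∎)))
    where open ℚ.≤-Reasoning

private module ℝR = CommutativeRing ℝ-ring
open SemiringSum ℝR.semiring using (sum)

sum-nonNegative : ∀ {n} (t : Fin n → ℝ) → (∀ k → PointwiseNonNegative (t k)) →
  PointwiseNonNegative (sum t)
sum-nonNegative {zero}  t 0≤t _ = ℚ.≤-refl
sum-nonNegative {suc n} t 0≤t = +-nonNegative (t zero) (sum (t ∘ suc))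
  (0≤t zero) (sum-nonNegative (t ∘ suc) (0≤t ∘ suc))

sum≈0 : ∀ {n} (t : Fin n → ℝ) → (∀ k → PointwiseNonNegative (t k)) →
  sum t ≈ᴿ 0ᴿ → ∀ k → t k ≈ᴿ 0ᴿ
sum≈0 t 0≤t s≈0 zero = summand≈0 (t zero) (sum (t ∘ suc))
  (0≤t zero) (sum-nonNegative (t ∘ suc) (0≤t ∘ suc)) s≈0
sum≈0 t 0≤t s≈0 (suc k) = sum≈0 (t ∘ suc) (0≤t ∘ suc)
  (summand≈0 (sum (t ∘ suc)) (t zero)
    (sum-nonNegative (t ∘ suc) (0≤t ∘ suc)) (0≤t zero)
    (ℝR.trans (ℝR.+-comm (sum (t ∘ suc)) (t zero)) s≈0))
  k

ℝ-local : Units.IsLocal ℝ-ring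
ℝ-local = 0≉1 , local

ℝ-formallyReal : Units.IsFormallyReal ℝ-ring
ℝ-formallyReal m n t s≈0 i j = square≈0 (t i j) (sum≈0 (λ j → t i j *ᴿ t i j)
  (λ j → square-nonNegative (t i j))
  (sum≈0 (λ i → sum (λ j → t i j *ᴿ t i j))
    (λ i → sum-nonNegative (λ j → t i j *ᴿ t i j) (λ j → square-nonNegative (t i j)))
    s≈0 i) j)

-- The update over ℝ

open import Defs

restrict : ∀ {N} n → MatSeries N → MatPoly N n
restrict n X k = X (toℕ k)

⟦restrict⟧ : ∀ {N} n (X : MatSeries N) d → d ℕ.< n → ⟦ restrict n X ⟧ d ≡ X d
⟦restrict⟧ (suc n) X zero    _         = refl
⟦restrict⟧ (suc n) X (suc d) (ℕ.s≤s d<n) = ⟦restrict⟧ n (X ∘ suc) d d<n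

⟦⟧-toℕ : ∀ {N n} (X : MatPoly N n) k → ⟦ X ⟧ (toℕ k) ≡ X k
⟦⟧-toℕ X zero    = refl
⟦⟧-toℕ X (suc k) = ⟦⟧-toℕ (X ∘ suc) k

⟦⟧-beyond : ∀ {N n} (X : MatPoly N n) d → n ≤ d → ⟦ X ⟧ d ≡ O d
⟦⟧-beyond {n = zero}  X d       _         = refl
⟦⟧-beyond {n = suc n} X (suc d) (ℕ.s≤s n≤d) = ⟦⟧-beyond (X ∘ suc) d n≤d

⟦⟧-all : ∀ {N n} (P : Matrix N → Set) → P (O 0) → (X : MatPoly N n) →
  (∀ k → P (X k)) → ∀ d → P (⟦ X ⟧ d)
⟦⟧-all {n = zero}  P P0 X PX d       = P0
⟦⟧-all {n = suc n} P P0 X PX zero    = PX zero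
⟦⟧-all {n = suc n} P P0 X PX (suc d) = ⟦⟧-all P P0 (X ∘ suc) (PX ∘ suc) d

⟦truncate⟧ : ∀ {N n m} (m≤n : m ≤ n) (X : MatPoly N n) d → d ℕ.< m →
  ⟦ truncate m≤n X ⟧ d ≡ ⟦ X ⟧ d
⟦truncate⟧ m≤n X d d<m = begin
  ⟦ truncate m≤n X ⟧ d              ≡⟨ cong ⟦ truncate m≤n X ⟧ (Fin.toℕ-fromℕ< d<m) ⟨
  ⟦ truncate m≤n X ⟧ (toℕ k)        ≡⟨ ⟦⟧-toℕ (truncate m≤n X) k ⟩
  X (inject≤ k m≤n)                 ≡⟨ ⟦⟧-toℕ X (inject≤ k m≤n) ⟨
  ⟦ X ⟧ (toℕ (inject≤ k m≤n))       ≡⟨ cong ⟦ X ⟧ (Fin.toℕ-inject≤ k m≤n) ⟩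
  ⟦ X ⟧ (toℕ k)                     ≡⟨ cong ⟦ X ⟧ (Fin.toℕ-fromℕ< d<m) ⟩
  ⟦ X ⟧ d                           ∎
  where
  open ≡.≡-Reasoning
  k = fromℕ< d<m

#0⇒unit : ∀ {x} → x # 0ᴿ → Unit x
#0⇒unit {x} x#0 = unit-resp
  (ℝR.trans (ℝR.+-congˡ (RingProperties.-0#≈0# ℝR.ring)) (ℝR.+-identityʳ x)) (#⇒unit x#0)

module _ {N : ℕ} where
  private module L = MatrixSeries ℝ-ring N
  open L using (module M; module MS; module SS)

  ≡⇒∼ : ∀ {n} {X Y : MatSeries N} → (∀ d → d ℕ.< n → X d ≡ Y d) → X MS.∼[ n ] Y
  ≡⇒∼ e = MS.mk∼ λ d d<n i j → ℝR.reflexive (cong (λ Z → Z i j) (e d d<n))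

  ≈⇒∼ : ∀ {n} {X Y : MatSeries N} → X ≈[ n ] Y → X MS.∼[ n ] Y
  ≈⇒∼ e = MS.mk∼ (_≈[_]_.coeff≈ e)

  ∼⇒≈ : ∀ {n} {X Y : MatSeries N} → X MS.∼[ n ] Y → X ≈[ n ] Y
  ∼⇒≈ e = mk≈[] (MS.at e)

  ≈ₛ⇒∼ : ∀ {n f g} → f ≈ₛ[ n ] g → f SS.∼[ n ] g
  ≈ₛ⇒∼ e = SS.mk∼ (_≈ₛ[_]_.coeff≈ e)

  ∼⇒≈ₛ : ∀ {n f g} → f SS.∼[ n ] g → f ≈ₛ[ n ] g
  ∼⇒≈ₛ e = mk≈ₛ[] (SS.at e)

  *t^≡shift : ∀ D (X : MatSeries N) d → (X *t^ D) d ≡ MS.shift D X d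
  *t^≡shift zero    X d       = refl
  *t^≡shift (suc D) X zero    = refl
  *t^≡shift (suc D) X (suc d) = *t^≡shift D X d

  *t^∼shift : ∀ {n} D (X : MatSeries N) → X *t^ D MS.∼[ n ] MS.shift D X
  *t^∼shift D X = ≡⇒∼ λ d _ → *t^≡shift D X d

  *t^-diagonal : ∀ D {X : MatSeries N} → Diagonal X → Diagonal (X *t^ D)
  *t^-diagonal zero    X-diagonal = X-diagonal
  *t^-diagonal (suc D) X-diagonal zero    i j _ = ℝR.refl
  *t^-diagonal (suc D) X-diagonal (suc d) = *t^-diagonal D X-diagonal d

  -- As the first D coefficients vanish, those from index D on form the quotient, and E of them
  -- determine the product with t^D modulo t^(D+E).
  quotient-by-t^ : ∀ D E (X : MatSeries N) → X MS.∼[ D ] O →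
    ⟦ restrict E (λ d → X (D +ℕ d)) ⟧ *t^ D ≈[ D +ℕ E ] X
  quotient-by-t^ D E X X∼0 = ∼⇒≈ (T.trans (*t^∼shift D _) (T.trans
    (MS.shift-cong D (≡⇒∼ (⟦restrict⟧ E (λ d → X (D +ℕ d)))))
    (MS.mk∼ λ d _ → MS.shift-unshift D X X∼0 d)))
    where module T = Ring (MS.mod (D +ℕ E))

  ⟦restrict⟧≈ : ∀ n (X : MatSeries N) → ⟦ restrict n X ⟧ ≈[ n ] X
  ⟦restrict⟧≈ n X = ∼⇒≈ (≡⇒∼ (⟦restrict⟧ n X))

  -- Existence of the updated quantities.

  module _ {D E : ℕ} (1≤E : 1 ≤ E) (E≤D : E ≤ D) (A : MatPoly N D) (ΔA : MatPoly N E)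
    (A-distinct : HasDistinctEigenvalues (⟦ A ⟧ 0)) (Q Λ : MatPoly N D)
    (dec : Decomposes D ⟦ A ⟧ ⟦ Q ⟧ ⟦ Λ ⟧) where
    private
      QᵀAQ∼Λ = ≈⇒∼ (proj₁ dec)
      QᵀQ∼I = ≈⇒∼ (proj₁ (proj₂ dec))

      0<D = ℕ.≤-trans 1≤E E≤D

    gap : Fin N → Fin N → Series
    gap i j = entry ⟦ truncate E≤D Λ ⟧ j j +ₛ (-ₛ entry ⟦ truncate E≤D Λ ⟧ i i)

    Λ₀-separated : ∀ i j → i ≢ j →
      Unit (⟦ Λ ⟧ 0 i i +ᴿ -ᴿ ⟦ Λ ⟧ 0 j j)
    Λ₀-separated = Diagonalisation.diagonal-separated ℝ-ring ℝ-local ℝ-formallyReal N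
      (⟦ A ⟧ 0) (⟦ Q ⟧ 0) (⟦ Λ ⟧ 0)
      QᵀAQ≈Λ QᵀQ≈I (proj₂ (proj₂ dec) 0)
      -- The eigenvectors form the columns of `V`, so the second index selects the eigenvector and
      -- the first its component.
      (proj₁ A-distinct) (λ i j → proj₁ (proj₂ (proj₂ A-distinct) j) i)
      (λ i j i≢j → #⇒unit (proj₁ (proj₂ A-distinct) i j i≢j))
      (λ i j → proj₂ (proj₂ (proj₂ (proj₂ A-distinct) j)) i)
      (λ j → let i , v#0 = proj₁ (proj₂ (proj₂ (proj₂ A-distinct) j)) in i , #0⇒unit v#0)
      where
      Q₀ᵀ : Matrix N
      Q₀ᵀ = (⟦ Q ⟧ ᵀ) 0

      -- Coefficient 0 of a product of series is a sum of one term, x + 0; the two uses of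
      -- `M.+-identityʳ` remove these zeros.
      QᵀAQ≈Λ : (Q₀ᵀ M.* ⟦ A ⟧ 0) M.* ⟦ Q ⟧ 0 M.≈ ⟦ Λ ⟧ 0
      QᵀAQ≈Λ = M.trans
        (M.sym (M.trans (M.+-identityʳ _) (M.*-congʳ {⟦ Q ⟧ 0} (M.+-identityʳ (Q₀ᵀ M.* ⟦ A ⟧ 0)))))
        (MS.at QᵀAQ∼Λ 0 0<D)

      QᵀQ≈I : Q₀ᵀ M.* ⟦ Q ⟧ 0 M.≈ M.1#
      QᵀQ≈I = M.trans (M.sym (M.+-identityʳ (Q₀ᵀ M.* ⟦ Q ⟧ 0))) (MS.at QᵀQ∼I 0 0<D)

    ⟦truncate⟧∼ : ∀ (X : MatPoly N D) → ⟦ truncate E≤D X ⟧ MS.∼[ E ] ⟦ X ⟧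
    ⟦truncate⟧∼ X = ≡⇒∼ (⟦truncate⟧ E≤D X)

    -- One existential covers both cases, so that `H` is a plain projection and each specification
    -- of it is recovered from the matching implication.
    inverse-gap : ∀ i j → ∃ λ h →
      (i ≢ j → h *ₛ gap i j ≈ₛ[ E ] 1ₛ) × (i ≡ j → h ≈ₛ[ E ] 0ₛ)
    inverse-gap i j with i Fin.≟ j
    ... | yes i≡j = 0ₛ , contradiction i≡j , λ _ → mk≈ₛ[] λ _ _ → ℝR.refl
    ... | no i≢j  =
      let x , gap₀x≈1 = gap₀-unit
          h , h*gap∼1 = SS.left-inverse E (gap i j) x (ℝR.trans (ℝR.*-comm x (gap i j 0)) gap₀x≈1)
      in h , (λ _ → ∼⇒≈ₛ h*gap∼1) , λ i≡j → contradiction i≡j i≢j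
      where
      gap₀-unit : Unit (gap i j 0)
      gap₀-unit = unit-resp
        (ℝR.+-cong (ℝR.sym (MS.at (⟦truncate⟧∼ Λ) 0 1≤E j j))
                   (ℝR.-‿cong (ℝR.sym (MS.at (⟦truncate⟧∼ Λ) 0 1≤E i i))))
        (Λ₀-separated j i (i≢j ∘ ≡.sym))

    update : Update E≤D A ΔA Q Λ
    update = record
      { ΔF = restrict E ΔF ; ΔG = restrict E ΔG ; S = restrict E S ; K = restrict E K
      ; ΔΛ = restrict E ΔΛ ; H = restrict E H ; ΔQ = restrict E ΔQ
      ; ΔF-eq = quotient-by-t^ D E _ (difference∼0 QᵀAQ∼Λ)
      ; ΔG-eq = quotient-by-t^ D E _ (difference∼0 QᵀQ∼I)
      ; S-eq = ⟦restrict⟧≈ E S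
      ; K-eq = ⟦restrict⟧≈ E K
      ; ΔΛ-eq = ⟦restrict⟧≈ E ΔΛ
      ; H-off = λ i j i≢j → ∼⇒≈ₛ (t.trans (t.*-congʳ {gap i j} (⟦H⟧∼ i j))
          (≈ₛ⇒∼ (proj₁ (proj₂ (inverse-gap i j)) i≢j)))
      ; H-diag = λ i → ∼⇒≈ₛ (t.trans (⟦H⟧∼ i i) (≈ₛ⇒∼ (proj₂ (proj₂ (inverse-gap i i)) refl)))
      ; ΔQ-eq = ⟦restrict⟧≈ E ΔQ
      }
      where
      module t = Ring (SS.mod E)
      module T = Ring (MS.mod D)

      difference∼0 : ∀ {X Y} → X MS.∼[ D ] Y → X - Y MS.∼[ D ] O
      difference∼0 {X} {Y} X∼Y = T.trans (T.+-congʳ {(- Y)} X∼Y) (T.-‿inverseʳ Y)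

      Q′ Λ′ : MatSeries N
      Q′ = ⟦ truncate E≤D Q ⟧
      Λ′ = ⟦ truncate E≤D Λ ⟧

      -- Each series is formed from the truncations of the earlier ones, so that `S-eq`, `K-eq`,
      -- `ΔΛ-eq` and `ΔQ-eq` only have to compare a series with its own truncation.
      ΔF ΔG S K ΔΛ H ΔQ : MatSeries N
      ΔF d = (⟦ Q ⟧ ᵀ * ⟦ A ⟧ * ⟦ Q ⟧ - ⟦ Λ ⟧) (D +ℕ d)
      ΔG d = (⟦ Q ⟧ ᵀ * ⟦ Q ⟧ - I) (D +ℕ d)
      S = fromℚ (ℚ.- ½) · ⟦ restrict E ΔG ⟧
      K = ⟦ restrict E ΔF ⟧ + Q′ ᵀ * ⟦ ΔA ⟧ * Q′ + ⟦ restrict E S ⟧ * Λ′ + Λ′ * ⟦ restrict E S ⟧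
      ΔΛ = I ⊙ ⟦ restrict E K ⟧
      H d i j = proj₁ (inverse-gap i j) d
      ΔQ = Q′ * (⟦ restrict E H ⟧ ⊙ (⟦ restrict E K ⟧ - ⟦ restrict E ΔΛ ⟧) + ⟦ restrict E S ⟧)

      ⟦H⟧∼ : ∀ i j → entry ⟦ restrict E H ⟧ i j SS.∼[ E ] proj₁ (inverse-gap i j)
      ⟦H⟧∼ = L.entry-cong (≡⇒∼ (⟦restrict⟧ E H))

    -- Every choice of updated quantities yields a decomposition modulo t^(D+E).

    module _ (A-symmetric : ∀ d → Symmetric (A d)) (ΔA-symmetric : ∀ d → Symmetric (ΔA d))
      (u : Update E≤D A ΔA Q Λ) where
      open Update u

      private
        module T = Ring (MS.mod (D +ℕ E))
        module T′ = Ring (MS.mod E)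
        module t = Ring (SS.mod E)

        ⟦⟧-symmetric : ∀ {n k} (X : MatPoly N n) → (∀ d → Symmetric (X d)) →
          ⟦ X ⟧ ᵀ MS.∼[ k ] ⟦ X ⟧
        ⟦⟧-symmetric X X-symmetric = MS.mk∼ λ d _ i j →
          ⟦⟧-all Symmetric (λ _ _ → ℝR.refl) X X-symmetric d j i

        module Step = L.UpdateStep D E E≤D (fromℚ (ℚ.- ½)) (pointwise λ _ → refl)
          ⟦ A ⟧ ⟦ ΔA ⟧ ⟦ Q ⟧ ⟦ Λ ⟧ ⟦ Q′ ⟧ ⟦ Λ′ ⟧ ⟦ ΔF ⟧ ⟦ ΔG ⟧ ⟦ S ⟧ ⟦ K ⟧ ⟦ ΔΛ ⟧ ⟦ H ⟧ ⟦ ΔQ ⟧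
          (⟦truncate⟧∼ Q) (⟦truncate⟧∼ Λ)
          (⟦⟧-symmetric A A-symmetric) (⟦⟧-symmetric ΔA ΔA-symmetric)
          QᵀAQ∼Λ QᵀQ∼I (proj₂ (proj₂ dec))
          (T.trans (T.sym (*t^∼shift D ⟦ ΔF ⟧)) (≈⇒∼ ΔF-eq))
          (T.trans (T.sym (*t^∼shift D ⟦ ΔG ⟧)) (≈⇒∼ ΔG-eq))
          (≈⇒∼ S-eq) (≈⇒∼ K-eq) (≈⇒∼ ΔΛ-eq)
          (λ i j i≢j → ≈ₛ⇒∼ (H-off i j i≢j)) (λ i → ≈ₛ⇒∼ (H-diag i))
          (≈⇒∼ ΔQ-eq)

        Q̃ Ã Λ̃ : MatSeries N
        Q̃ = ⟦ Q ⟧ + ⟦ ΔQ ⟧ *t^ D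
        Ã = ⟦ A ⟧ + ⟦ ΔA ⟧ *t^ D
        Λ̃ = ⟦ Λ ⟧ + ⟦ ΔΛ ⟧ *t^ D

        +*t^∼ : ∀ X Y → X + Y *t^ D MS.∼[ D +ℕ E ] X + MS.shift D Y
        +*t^∼ X Y = T.+-congˡ {X} (*t^∼shift D Y)

        Q̃∼ : Q̃ MS.∼[ D +ℕ E ] Step.Q̃
        Q̃∼ = +*t^∼ ⟦ Q ⟧ ⟦ ΔQ ⟧

        -- `Diagonal` concerns all coefficients, while the congruence for `ΔΛ` controls those below
        -- E only; the others vanish because `ΔΛ` is a polynomial with E coefficients.
        ΔΛ-diagonal : Diagonal ⟦ ΔΛ ⟧
        ΔΛ-diagonal d i j i≢j with d ℕ.<? E
        ... | yes d<E = Step.ΔΛ-off-diagonal d d<E i j i≢j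
        ... | no d≮E  = ℝR.reflexive (cong (λ Z → Z i j) (⟦⟧-beyond ΔΛ d (ℕ.≮⇒≥ d≮E)))

      updated-decomposes : Decomposes (D +ℕ E) Ã Q̃ Λ̃
      updated-decomposes =
          ∼⇒≈ (T.trans (T.*-cong (T.*-cong (L.ᵀ-cong Q̃∼) (+*t^∼ ⟦ A ⟧ ⟦ ΔA ⟧)) Q̃∼)
            (T.trans Step.update-diagonalises (T.sym (+*t^∼ ⟦ Λ ⟧ ⟦ ΔΛ ⟧))))
        , ∼⇒≈ (T.trans (T.*-cong (L.ᵀ-cong Q̃∼) Q̃∼) Step.update-orthogonal)
        , λ d i j i≢j → ℝR.trans
            (ℝR.+-cong (proj₂ (proj₂ dec) d i j i≢j) (*t^-diagonal D ΔΛ-diagonal d i j i≢j))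
            (ℝR.+-identityʳ 0ᴿ)

mainTheorem3 : (N D E : ℕ) → 1 ≤ N → 1 ≤ E → (E≤D : E ≤ D) →
    (A : MatPoly N D) (ΔA : MatPoly N E) →
    (∀ d → Symmetric (A d)) → (∀ d → Symmetric (ΔA d)) →
    HasDistinctEigenvalues (⟦ A ⟧ 0) →
    (Q Λ : MatPoly N D) →
    Decomposes D ⟦ A ⟧ ⟦ Q ⟧ ⟦ Λ ⟧ →
    Update E≤D A ΔA Q Λ ×
    ((u : Update E≤D A ΔA Q Λ) →
    Decomposes (D +ℕ E)
    (⟦ A ⟧ + ⟦ ΔA ⟧ *t^ D)
    (⟦ Q ⟧ + ⟦ Update.ΔQ u ⟧ *t^ D)
    (⟦ Λ ⟧ + ⟦ Update.ΔΛ u ⟧ *t^ D))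
mainTheorem3 N D E 1≤N 1≤E E≤D A ΔA A-symmetric ΔA-symmetric A-distinct Q Λ dec =
    update 1≤E E≤D A ΔA A-distinct Q Λ dec
  , updated-decomposes 1≤E E≤D A ΔA A-distinct Q Λ dec A-symmetric ΔA-symmetric
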